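{- For any fixed integer $m\ge 3$, as $n\to\infty$, \[ \tilde r(m,n)=O_m\left(\frac{n^m}{(\log n)^{\lfloor m/2\rfloor-1}}\right). \]
   Context: The $(m,n)$-online Ramsey game is played by two players, Builder and Painter, on an infinite set of initially isolated vertices. Each turn, Builder places an edge between two nonadjacent vertices and Painter immediately paints it red or blue. The online Ramsey number $\tilde r(m,n)$ is the smallest number of turns within which Builder can guarantee the existence of either a red $K_m$ or a blue $K_n$, whatever Painter does. Logarithms are natural; the implicit constant in $O_m$ depends only on $m$. -}

module Defs where

open import Data.List using (List; []; _∷_; _++_; length; map; filter; upTo)
open import Data.List.Properties using (length-map; length-upTo)
open import Data.List.Membership.Propositional using (_∈_)
open import Data.List.Membership.Propositional.Properties using (∈-map⁺; ∈-map⁻)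
open import Data.List.Relation.Unary.All as All using (All; []; _∷_)
import Data.List.Relation.Unary.All.Properties as All
open import Data.List.Relation.Unary.AllPairs as AllPairs using (AllPairs; []; _∷_)
import Data.List.Relation.Unary.AllPairs.Properties as AllPairs
open import Data.List.Relation.Unary.Any using (here; there)
open import Data.List.Relation.Unary.Unique.Propositional using (Unique)
open import Data.List.Relation.Unary.Unique.Propositional.Properties using (upTo⁺)
import Data.List.Membership.DecPropositional as DecMembership
open import Data.Nat
open import Data.Nat.Properties
open import Data.Product using (Σ-syntax; ∃; ∃-syntax; _×_; _,_; proj₁; proj₂)
open import Data.Product.Properties using () renaming (≡-dec to ×-≡-dec)
open import Data.Sum using (_⊎_; inj₁; inj₂)
import Data.Integer as ℤ
open import Data.Rational as ℚ using (ℚ; 0ℚ)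
open import Algebra.Definitions.RawSemiring ℚ.+-*-rawSemiring using () renaming (_^_ to _^ℚ_)
open import Function using (_∘_; id)
open import Function.Definitions using (Injective)
open import Relation.Binary.Definitions using (DecidableEquality)
open import Relation.Binary.PropositionalEquality
open import Relation.Nullary using (¬_; Dec; yes; no; contradiction)
open import Relation.Nullary.Decidable using (map′; _×-dec_; _⊎-dec_; ¬?)
open import Relation.Unary using (Decidable)

------------------------------------------------------------------------
-- The game. Vertices are natural numbers; a board lists the edges drawn
-- so far, latest first, each with the colour Painter gave it.

data Colour : Set where
  red blue : Colour

Board : Set
Board = List (Colour × ℕ × ℕ)

-- Edges are undirected, although Builder names the endpoints in some order.
Edge : Board → Colour → ℕ → ℕ → Set
Edge b c u v = (c , u , v) ∈ b ⊎ (c , v , u) ∈ b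

Adjacent : Board → ℕ → ℕ → Set
Adjacent b u v = ∃[ c ] Edge b c u v

Clique : Board → Colour → ℕ → Set
Clique b c k =
  Σ[ vs ∈ List ℕ ] length vs ≡ k × Unique vs × AllPairs (Edge b c) vs

Won : ℕ → ℕ → Board → Set
Won m n b = Clique b red m ⊎ Clique b blue n

-- BuilderWins m n t b: starting from b, Builder can force a red K_m or a
-- blue K_n within at most t further turns.
data BuilderWins (m n : ℕ) : ℕ → Board → Set where
  won  : ∀ {t b} → Won m n b → BuilderWins m n t b
  turn : ∀ {t b} u v → u ≢ v → ¬ Adjacent b u v →
         (∀ c → BuilderWins m n t ((c , u , v) ∷ b)) →
         BuilderWins m n (suc t) b

IsOnlineRamseyNumber : ℕ → ℕ → ℕ → Set
IsOnlineRamseyNumber m n r =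
  BuilderWins m n r [] × (∀ t → BuilderWins m n t [] → r ≤ t)

------------------------------------------------------------------------
-- BuilderWins is decidable. The infinitely many possible moves reduce to
-- finitely many, as the vertices not yet touched are interchangeable.

private

  _≟ᶜ_ : DecidableEquality Colour
  red  ≟ᶜ red  = yes refl
  red  ≟ᶜ blue = no λ ()
  blue ≟ᶜ red  = no λ ()
  blue ≟ᶜ blue = yes refl

  open DecMembership (×-≡-dec _≟ᶜ_ (×-≡-dec _≟_ _≟_)) using (_∈?_)

  edge? : ∀ b c u v → Dec (Edge b c u v)
  edge? b c u v = ((c , u , v) ∈? b) ⊎-dec ((c , v , u) ∈? b)

  adjacent? : ∀ b u v → Dec (Adjacent b u v)
  adjacent? b u v = map′ to from (edge? b red u v ⊎-dec edge? b blue u v)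
    where
    to : Edge b red u v ⊎ Edge b blue u v → Adjacent b u v
    to (inj₁ e) = red , e
    to (inj₂ e) = blue , e
    from : Adjacent b u v → Edge b red u v ⊎ Edge b blue u v
    from (red  , e) = inj₁ e
    from (blue , e) = inj₂ e

  bound : Board → ℕ
  bound []                = 0
  bound ((_ , u , v) ∷ b) = (suc u ⊔ suc v) ⊔ bound b

  bounded : ∀ {c u v} b → (c , u , v) ∈ b → u < bound b × v < bound b
  bounded ((_ , u , v) ∷ b) (here refl) =
    ≤-trans (m≤m⊔n (suc u) (suc v)) (m≤m⊔n _ (bound b)) ,
    ≤-trans (m≤n⊔m (suc u) (suc v)) (m≤m⊔n _ (bound b))
  bounded ((_ , u , v) ∷ b) (there e) with bounded b e
  ... | p , q = ≤-trans p (m≤n⊔m (suc u ⊔ suc v) _) ,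
                ≤-trans q (m≤n⊔m (suc u ⊔ suc v) _)

  edge-bounded : ∀ {c u v} b → Edge b c u v → u < bound b × v < bound b
  edge-bounded b (inj₁ e) = bounded b e
  edge-bounded b (inj₂ e) with bounded b e
  ... | p , q = q , p

  boundedList? : ∀ k M {P : List ℕ → Set} → Decidable P →
                 Dec (∃[ vs ] length vs ≡ k × All (_< M) vs × P vs)
  boundedList? zero M {P} P? =
    map′ (λ p → [] , refl , [] , p) from (P? [])
    where
    from : ∃[ vs ] length vs ≡ 0 × All (_< M) vs × P vs → P []
    from ([] , _ , _ , p) = p
  boundedList? (suc k) M {P} P? =
    map′ to from (anyUpTo? (λ v → boundedList? k M (P? ∘ (v ∷_))) M)
    where
    to : (∃ λ v → v < M × ∃[ vs ] length vs ≡ k × All (_< M) vs × P (v ∷ vs)) →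
         ∃[ vs ] length vs ≡ suc k × All (_< M) vs × P vs
    to (v , v<M , vs , refl , vs<M , p) = v ∷ vs , refl , v<M ∷ vs<M , p
    from : ∃[ vs ] length vs ≡ suc k × All (_< M) vs × P vs →
           (∃ λ v → v < M × ∃[ vs ] length vs ≡ k × All (_< M) vs × P (v ∷ vs))
    from (v ∷ vs , refl , v<M ∷ vs<M , p) = v , v<M , vs , refl , vs<M , p

  clique-bounded : ∀ b c {v w vs} → AllPairs (Edge b c) (v ∷ w ∷ vs) →
                   All (_< bound b) (v ∷ w ∷ vs)
  clique-bounded b c ((e ∷ es) ∷ _) =
    proj₁ (edge-bounded b e) ∷ All.map (proj₂ ∘ edge-bounded b) (e ∷ es)

  clique? : ∀ b c k → Dec (Clique b c k)
  clique? b c 0 = yes ([] , refl , [] , [])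
  clique? b c 1 = yes (0 ∷ [] , refl , [] ∷ [] , [] ∷ [])
  clique? b c k@(suc (suc _)) = map′ to from
    (boundedList? k (bound b) λ vs →
      AllPairs.allPairs? (λ x y → ¬? (x ≟ y)) vs ×-dec
      AllPairs.allPairs? (edge? b c) vs)
    where
    Bounded : Set
    Bounded = ∃[ vs ] length vs ≡ k × All (_< bound b) vs ×
                      Unique vs × AllPairs (Edge b c) vs
    to : Bounded → Clique b c k
    to (vs , l , _ , p) = vs , l , p
    from : Clique b c k → Bounded
    from (v ∷ w ∷ vs , l , uq , es) =
      v ∷ w ∷ vs , l , clique-bounded b c es , uq , es

  won? : ∀ m n b → Dec (Won m n b)
  won? m n b = clique? b red m ⊎-dec clique? b blue n

  relabel : (ℕ → ℕ) → Board → Board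
  relabel σ = map λ (c , u , v) → c , σ u , σ v

  module Relabel (σ : ℕ → ℕ) (inj : Injective _≡_ _≡_ σ) where

    edge⁺ : ∀ {b c u v} → Edge b c u v → Edge (relabel σ b) c (σ u) (σ v)
    edge⁺ (inj₁ e) = inj₁ (∈-map⁺ _ e)
    edge⁺ (inj₂ e) = inj₂ (∈-map⁺ _ e)

    ∈-relabel⁻ : ∀ {b c u v} → (c , σ u , σ v) ∈ relabel σ b → (c , u , v) ∈ b
    ∈-relabel⁻ {b} {c} e with ∈-map⁻ _ e
    ... | (_ , _ , _) , e′ , eq =
      subst (_∈ b) (sym (cong₂ _,_ (cong proj₁ eq)
        (cong₂ _,_ (inj (cong (proj₁ ∘ proj₂) eq))
                   (inj (cong (proj₂ ∘ proj₂) eq))))) e′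

    adjacent⁻ : ∀ {b u v} → Adjacent (relabel σ b) (σ u) (σ v) → Adjacent b u v
    adjacent⁻ (c , inj₁ e) = c , inj₁ (∈-relabel⁻ e)
    adjacent⁻ (c , inj₂ e) = c , inj₂ (∈-relabel⁻ e)

    clique⁺ : ∀ {b c k} → Clique b c k → Clique (relabel σ b) c k
    clique⁺ (vs , refl , uq , es) =
      map σ vs , length-map σ vs ,
      AllPairs.map⁺ (AllPairs.map (_∘ inj) uq) ,
      AllPairs.map⁺ (AllPairs.map edge⁺ es)

    wins⁺ : ∀ {m n t b} → BuilderWins m n t b → BuilderWins m n t (relabel σ b)
    wins⁺ (won (inj₁ k)) = won (inj₁ (clique⁺ k))
    wins⁺ (won (inj₂ k)) = won (inj₂ (clique⁺ k))
    wins⁺ (turn u v u≢v fresh next) =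
      turn (σ u) (σ v) (u≢v ∘ inj) (fresh ∘ adjacent⁻) (λ c → wins⁺ (next c))

  swap : ℕ → ℕ → ℕ → ℕ
  swap a c x with x ≟ a | x ≟ c
  ... | yes _ | _     = c
  ... | no _  | yes _ = a
  ... | no _  | no _  = x

  swap-involutive : ∀ a c x → swap a c (swap a c x) ≡ x
  swap-involutive a c x with x ≟ a | x ≟ c
  swap-involutive a c x | yes refl | _ with c ≟ a | c ≟ c
  ... | yes c≡a | _       = c≡a
  ... | no _    | yes _   = refl
  ... | no _    | no c≢c  = contradiction refl c≢c
  swap-involutive a c x | no _ | yes refl with a ≟ a
  ... | yes _   = refl
  ... | no a≢a  = contradiction refl a≢a
  swap-involutive a c x | no x≢a | no x≢c with x ≟ a | x ≟ c
  ... | yes x≡a | _       = contradiction x≡a x≢a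
  ... | no _    | yes x≡c = contradiction x≡c x≢c
  ... | no _    | no _    = refl

  swap-injective : ∀ a c → Injective _≡_ _≡_ (swap a c)
  swap-injective a c {x} {y} eq =
    trans (sym (swap-involutive a c x))
          (trans (cong (swap a c) eq) (swap-involutive a c y))

  swap-fixes : ∀ a c x → x ≢ a → x ≢ c → swap a c x ≡ x
  swap-fixes a c x x≢a x≢c with x ≟ a | x ≟ c
  ... | yes x≡a | _       = contradiction x≡a x≢a
  ... | no _    | yes x≡c = contradiction x≡c x≢c
  ... | no _    | no _    = refl

  swap-left : ∀ a c → swap a c a ≡ c
  swap-left a c with a ≟ a
  ... | yes _  = refl
  ... | no a≢a = contradiction refl a≢a

  lower : ∀ M u → Σ[ σ ∈ (ℕ → ℕ) ] Injective _≡_ _≡_ σ ×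
                  (∀ x → x < M → σ x ≡ x) × σ u ≤ M
  lower M u with u <? M
  ... | yes u<M = id , id , (λ _ _ → refl) , <⇒≤ u<M
  ... | no  u≮M =
    swap u M , swap-injective u M ,
    (λ x x<M → swap-fixes u M x (λ { refl → u≮M x<M }) (<⇒≢ x<M)) ,
    ≤-reflexive (swap-left u M)

  lower₂ : ∀ M u v → Σ[ σ ∈ (ℕ → ℕ) ] Injective _≡_ _≡_ σ ×
                     (∀ x → x < M → σ x ≡ x) × σ u < 2 + M × σ v < 2 + M
  lower₂ M u v with lower M u
  ... | σ , σ-inj , σ-fix , σu≤M with lower (suc M) (σ v)
  ...   | τ , τ-inj , τ-fix , τσv≤ =
    τ ∘ σ , σ-inj ∘ τ-inj ,
    (λ x x<M → trans (cong τ (σ-fix x x<M)) (τ-fix x (m<n⇒m<1+n x<M))) ,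
    s≤s (subst (_≤ suc M) (sym (τ-fix (σ u) (s≤s σu≤M))) (m≤n⇒m≤1+n σu≤M)) ,
    s≤s τσv≤

  relabel-fixes : ∀ M σ b → bound b ≤ M → (∀ x → x < M → σ x ≡ x) →
                  relabel σ b ≡ b
  relabel-fixes M σ [] _ _ = refl
  relabel-fixes M σ ((c , u , v) ∷ b) le fix = cong₂ _∷_
    (cong (c ,_) (cong₂ _,_
      (fix u (≤-trans (proj₁ (bounded ((c , u , v) ∷ b) (here refl))) le))
      (fix v (≤-trans (proj₂ (bounded ((c , u , v) ∷ b) (here refl))) le))))
    (relabel-fixes M σ b (≤-trans (m≤n⊔m (suc u ⊔ suc v) _) le) fix)

  Move : ℕ → ℕ → ℕ → Board → ℕ → ℕ → Set
  Move m n t b u v = u ≢ v × ¬ Adjacent b u v ×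
    BuilderWins m n t ((red , u , v) ∷ b) ×
    BuilderWins m n t ((blue , u , v) ∷ b)

  BoundedMove : ℕ → ℕ → ℕ → Board → Set
  BoundedMove m n t b =
    ∃ λ u → u < 2 + bound b × ∃ λ v → v < 2 + bound b × Move m n t b u v

  bounded-move : ∀ {m n t b} → BuilderWins m n (suc t) b →
                 Won m n b ⊎ BoundedMove m n t b
  bounded-move (won w) = inj₁ w
  bounded-move {m} {n} {t} {b} (turn u v u≢v fresh next)
    with lower₂ (bound b) u v
  ... | σ , σ-inj , σ-fix , σu< , σv< =
    inj₂ (σ u , σu< , σ v , σv< , u≢v ∘ σ-inj ,
      (λ a → fresh (adjacent⁻ (subst (λ b′ → Adjacent b′ (σ u) (σ v)) (sym eq) a))) ,
      next′ red , next′ blue)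
    where
    open Relabel σ σ-inj
    eq : relabel σ b ≡ b
    eq = relabel-fixes (bound b) σ b ≤-refl σ-fix
    next′ : ∀ c → BuilderWins m n t ((c , σ u , σ v) ∷ b)
    next′ c = subst (λ b′ → BuilderWins m n t ((c , σ u , σ v) ∷ b′)) eq
                    (wins⁺ (next c))

  move⇒wins : ∀ {m n t b} → Won m n b ⊎ BoundedMove m n t b →
              BuilderWins m n (suc t) b
  move⇒wins (inj₁ w) = won w
  move⇒wins (inj₂ (u , _ , v , _ , u≢v , fresh , r , l)) =
    turn u v u≢v fresh λ { red → r ; blue → l }

builderWins? : ∀ m n t b → Dec (BuilderWins m n t b)
builderWins? m n zero b = map′ won (λ { (won w) → w }) (won? m n b)
builderWins? m n (suc t) b = map′ move⇒wins bounded-move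
  (won? m n b ⊎-dec
   anyUpTo? (λ u → anyUpTo? (λ v →
     ¬? (u ≟ v) ×-dec ¬? (adjacent? b u v) ×-dec
     builderWins? m n t ((red , u , v) ∷ b) ×-dec
     builderWins? m n t ((blue , u , v) ∷ b)) (2 + bound b)) (2 + bound b))

------------------------------------------------------------------------
-- Builder wins eventually: drawing a large enough complete graph suffices,
-- by Ramsey's theorem.

private

  length-filter₂ : ∀ {P Q : ℕ → Set} (P? : Decidable P) (Q? : Decidable Q) xs →
                   All (λ x → P x ⊎ Q x) xs →
                   length xs ≤ length (filter P? xs) + length (filter Q? xs)
  length-filter₂ P? Q? [] [] = z≤n
  length-filter₂ P? Q? (x ∷ xs) (pq ∷ pqs)
    with P? x | Q? x | length-filter₂ P? Q? xs pqs
  ... | yes _ | yes _ | ih = s≤s (≤-trans ih (+-monoʳ-≤ _ (n≤1+n _)))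
  ... | yes _ | no _  | ih = s≤s ih
  ... | no _  | yes _ | ih = ≤-trans (s≤s ih) (≤-reflexive (sym (+-suc _ _)))
  ... | no ¬p | no ¬q | _  with pq
  ...   | inj₁ p = contradiction p ¬p
  ...   | inj₂ q = contradiction q ¬q

  split-≤ : ∀ a b c d → a + b ≤ c + d → a ≤ c ⊎ b ≤ d
  split-≤ a b c d le with a ≤? c | b ≤? d
  ... | yes p | _     = inj₁ p
  ... | no _  | yes q = inj₂ q
  ... | no ¬p | no ¬q =
    contradiction le (<⇒≱ (+-mono-< (≰⇒> ¬p) (≰⇒> ¬q)))

  CliqueIn : Board → Colour → ℕ → (ℕ → Set) → Set
  CliqueIn b c k P = Σ[ vs ∈ List ℕ ]
    length vs ≡ k × Unique vs × AllPairs (Edge b c) vs × All P vs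

  weaken : ∀ {b c k P Q} → (∀ {x} → P x → Q x) →
           CliqueIn b c k P → CliqueIn b c k Q
  weaken f (vs , l , uq , es , ps) = vs , l , uq , es , All.map f ps

  extend : ∀ {b c k x P} → P x →
           CliqueIn b c k (λ y → Edge b c x y × x ≢ y × P y) →
           CliqueIn b c (suc k) P
  extend {x = x} px (vs , l , uq , es , ps) =
    x ∷ vs , cong suc l , All.map (proj₁ ∘ proj₂) ps ∷ uq ,
    All.map proj₁ ps ∷ es , px ∷ All.map (proj₂ ∘ proj₂) ps

  R : ℕ → ℕ → ℕ
  R zero    n       = 0
  R (suc m) zero    = 0
  R (suc m) (suc n) = suc (R m (suc n) + R (suc m) n)

  ramsey : ∀ m n b {P : ℕ → Set} xs → Unique xs → AllPairs (Adjacent b) xs →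
           All P xs → R m n ≤ length xs →
           CliqueIn b red m P ⊎ CliqueIn b blue n P
  ramsey zero n b xs _ _ _ _ = inj₁ ([] , refl , [] , [] , [])
  ramsey (suc m) zero b xs _ _ _ _ = inj₂ ([] , refl , [] , [] , [])
  ramsey (suc m) (suc n) b {P} (x ∷ xs) (x∉ ∷ uq) (adj ∷ adjs) (px ∷ ps) (s≤s le)
    with split-≤ (R m (suc n)) (R (suc m) n) _ _
           (≤-trans le (length-filter₂ (edge? b red x) (edge? b blue x) xs
             (All.map (λ { (red , e) → inj₁ e ; (blue , e) → inj₂ e }) adj)))
  ... | inj₁ le₁
    with ramsey m (suc n) b {λ y → Edge b red x y × x ≢ y × P y}
           (filter (edge? b red x) xs)
           (AllPairs.filter⁺ (edge? b red x) uq)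
           (AllPairs.filter⁺ (edge? b red x) adjs)
           (All.zip (All.all-filter (edge? b red x) xs ,
                     All.filter⁺ (edge? b red x) (All.zip (x∉ , ps)))) le₁
  ...   | inj₁ k = inj₁ (extend px k)
  ...   | inj₂ k = inj₂ (weaken (proj₂ ∘ proj₂) k)
  ramsey (suc m) (suc n) b {P} (x ∷ xs) (x∉ ∷ uq) (adj ∷ adjs) (px ∷ ps) (s≤s le)
      | inj₂ le₂
    with ramsey (suc m) n b {λ y → Edge b blue x y × x ≢ y × P y}
           (filter (edge? b blue x) xs)
           (AllPairs.filter⁺ (edge? b blue x) uq)
           (AllPairs.filter⁺ (edge? b blue x) adjs)
           (All.zip (All.all-filter (edge? b blue x) xs ,
                     All.filter⁺ (edge? b blue x) (All.zip (x∉ , ps)))) le₂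
  ...   | inj₁ k = inj₁ (weaken (proj₂ ∘ proj₂) k)
  ...   | inj₂ k = inj₂ (extend px k)

  wins-suc : ∀ {m n t b} → BuilderWins m n t b → BuilderWins m n (suc t) b
  wins-suc (won w)                 = won w
  wins-suc (turn u v u≢v fresh next) = turn u v u≢v fresh (λ c → wins-suc (next c))

  _⊑_ : Board → Board → Set
  b ⊑ b′ = ∀ {e} → e ∈ b → e ∈ b′

  adjacent-mono : ∀ {b b′ u v} → b ⊑ b′ → Adjacent b u v → Adjacent b′ u v
  adjacent-mono s (c , inj₁ e) = c , inj₁ (s e)
  adjacent-mono s (c , inj₂ e) = c , inj₂ (s e)

  draw : ∀ {m n} (es : List (ℕ × ℕ)) b → All (λ (u , v) → u ≢ v) es →
         (∀ b′ → b ⊑ b′ → All (λ (u , v) → Adjacent b′ u v) es → Won m n b′) →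
         BuilderWins m n (length es) b
  draw [] b [] done = won (done b id [])
  draw ((u , v) ∷ es) b (u≢v ∷ ds) done with adjacent? b u v
  ... | yes a = wins-suc (draw es b ds
        (λ b′ s as → done b′ s (adjacent-mono s a ∷ as)))
  ... | no ¬a = turn u v u≢v ¬a λ c → draw es ((c , u , v) ∷ b) ds
        (λ b′ s as → done b′ (s ∘ there) ((c , inj₁ (s (here refl))) ∷ as))

  pairs : List ℕ → List (ℕ × ℕ)
  pairs []       = []
  pairs (x ∷ xs) = map (x ,_) xs ++ pairs xs

  pairs⁺ : ∀ {Q : ℕ → ℕ → Set} {xs} → AllPairs Q xs → All (λ (u , v) → Q u v) (pairs xs)
  pairs⁺ []       = []
  pairs⁺ (q ∷ qs) = All.++⁺ (All.map⁺ q) (pairs⁺ qs)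

  pairs⁻ : ∀ {Q : ℕ → ℕ → Set} xs → All (λ (u , v) → Q u v) (pairs xs) → AllPairs Q xs
  pairs⁻ []       _  = []
  pairs⁻ (x ∷ xs) qs =
    All.map⁻ (All.++⁻ˡ (map (x ,_) xs) qs) ∷
    pairs⁻ xs (All.++⁻ʳ (map (x ,_) xs) qs)

builderWins-eventually : ∀ m n → ∃[ t ] BuilderWins m n t []
builderWins-eventually m n = length (pairs xs) , draw (pairs xs) [] (pairs⁺ (upTo⁺ N)) done
  where
  N : ℕ
  N = R m n
  xs : List ℕ
  xs = upTo N
  forget : ∀ {b c k} → CliqueIn b c k (λ _ → ℕ) → Clique b c k
  forget (vs , l , uq , es , _) = vs , l , uq , es
  done : ∀ b′ → [] ⊑ b′ → All (λ (u , v) → Adjacent b′ u v) (pairs xs) → Won m n b′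
  done b′ _ as with ramsey m n b′ {λ _ → ℕ} xs (upTo⁺ N) (pairs⁻ xs as)
                      (All.universal id xs) (≤-reflexive (sym (length-upTo N)))
  ... | inj₁ k = inj₁ (forget k)
  ... | inj₂ k = inj₂ (forget k)

private
  least : ∀ {P : ℕ → Set} → Decidable P → ∀ t → P t →
          ∃[ r ] P r × (∀ s → P s → r ≤ s)
  least P? t p with P? 0
  ... | yes p₀ = 0 , p₀ , λ _ _ → z≤n
  least P? zero    p | no ¬p₀ = contradiction p ¬p₀
  least P? (suc t) p | no ¬p₀ with least (P? ∘ suc) t p
  ... | r , pr , min = suc r , pr ,
    λ { zero p₀ → contradiction p₀ ¬p₀ ; (suc s) ps → s≤s (min s ps) }

abstract
  onlineRamseyNumber : ∀ m n → ∃[ r ] IsOnlineRamseyNumber m n r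
  onlineRamseyNumber m n with builderWins-eventually m n
  ... | t , w = least (λ t → builderWins? m n t []) t w

-- The online Ramsey number.
r̃ : ℕ → ℕ → ℕ
r̃ m n = proj₁ (onlineRamseyNumber m n)

r̃-correct : ∀ m n → IsOnlineRamseyNumber m n (r̃ m n)
r̃-correct m n = proj₂ (onlineRamseyNumber m n)

------------------------------------------------------------------------
-- The natural logarithm

fromℕ : ℕ → ℚ
fromℕ n = ℤ.+ n ℚ./ 1

-- expSum q k = Σ_{i<k} qⁱ / i!
expSum : ℚ → ℕ → ℚ
expSum q zero    = 0ℚ
expSum q (suc k) = expSum q k ℚ.+ (q ^ℚ k) ℚ.* (ℤ.1ℤ ℚ./ (k !)) {{k !≢0}}

-- The rationals in the real interval [0 , log n], for n ≥ 1. For q ≥ 0 the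
-- partial sums increase to exp q, so q ≤ log n iff all of them are ≤ n.
_∈[0,log_] : ℚ → ℕ → Set
q ∈[0,log n ] = 0ℚ ℚ.≤ q × (∀ k → expSum q k ℚ.≤ fromℕ n)

-- a ·[log n ]^ k ≤ c expresses the real inequality a (log n)ᵏ ≤ c, as (log n)ᵏ
-- is the supremum of qᵏ over the rationals q in [0 , log n].
infix 4 _·[log_]^_≤_
_·[log_]^_≤_ : ℕ → ℕ → ℕ → ℕ → Set
a ·[log n ]^ k ≤ c =
  ∀ q → q ∈[0,log n ] → fromℕ a ℚ.* (q ^ℚ k) ℚ.≤ fromℕ c

module Submission where

-- Let i = ⌊m/2⌋ - 1 and k = i + 2. Builder first draws stars: connecting a vertex
-- to all remaining candidates leaves either a 1/n fraction of them as red
-- neighbours, which lowers the wanted red clique by one, or loses at most a 1/n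
-- fraction of them, so that n such steps give a blue K_n. After m - k red steps
-- Builder draws a complete graph on N₀ = O(n^(k-1) / (log n)^(k-2)) vertices. The
-- stars cost O(n^(m-k+1) N₀) edges and, as 2(k-1) ≤ m, the complete graph is cheap.
--
-- That N₀ vertices suffice is the bound of Ajtai, Komlós and Szemerédi. If the
-- red graph has degrees at most d and its edges lie in few triangles, a
-- random independent set (in the hard-core model, as in Alon's proof) has mean
-- size of order (N/d) log n: given its restriction J to the non-neighbours of v,
-- either v is occupied with good probability, or the vertices of N(v) not
-- adjacent to J support so many independent sets that the mean number of
-- occupied ones is large.

open import Defs
import Data.Integer as ℤ
import Data.Integer.Properties as ℤ
open import Data.List using (List; []; _∷_; _++_; length; map; filter; take; upTo)
open import Data.List.Properties using (length-++; length-take; length-upTo; map-++)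
import Data.List.Membership.DecPropositional as DecMembership
open import Data.List.Membership.Propositional using (_∈_)
open import Data.List.Membership.Propositional.Properties
  using (∈-∃++; ∈-++⁺ʳ; ∈-filter⁺; ∈-filter⁻)
open import Data.List.Relation.Binary.Permutation.Propositional
  using (_↭_; prep; swap; ↭-refl; ↭-sym; ↭-trans; ↭⇒↭ₛ)
import Data.List.Relation.Binary.Permutation.Propositional as Perm
import Data.List.Relation.Binary.Permutation.Propositional.Properties as Perm
import Data.List.Relation.Binary.Permutation.Setoid.Properties as PermSetoid
open import Data.List.Relation.Binary.Sublist.Propositional using (_⊆_; []; _∷_; _∷ʳ_)
import Data.List.Relation.Binary.Sublist.Propositional as Sublist
import Data.List.Relation.Binary.Sublist.Propositional.Properties as Sublist
open import Data.List.Relation.Unary.All as All using (All; []; _∷_)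
import Data.List.Relation.Unary.All.Properties as All
open import Data.List.Relation.Unary.AllPairs as AllPairs using (AllPairs; []; _∷_)
import Data.List.Relation.Unary.AllPairs.Properties as AllPairs
open import Data.List.Relation.Unary.Any using (here; there)
open import Data.List.Relation.Unary.Unique.Propositional using (Unique)
open import Data.List.Relation.Unary.Unique.Propositional.Properties using (upTo⁺)
open import Data.Nat
open import Data.Nat.DivMod using (m/n*n≤m; /-monoˡ-≤; m*n/n≡m)
open import Data.Nat.ListAction using (sum)
open import Data.Nat.ListAction.Properties using (sum-↭; sum-++)
open import Data.Nat.Properties
open import Data.Nat.Tactic.RingSolver using (solve-∀)
open import Data.Product using (Σ-syntax; ∃-syntax; _×_; _,_; proj₁; proj₂)
open import Data.Product.Properties using () renaming (≡-dec to ×-≡-dec)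
open import Data.Rational as ℚ using (ℚ; 0ℚ; 1ℚ)
import Data.Rational.Properties as ℚ
open import Data.Rational.Unnormalised as ℚᵘ using (mkℚᵘ)
import Data.Rational.Unnormalised.Properties as ℚᵘ
open import Data.Sum using (inj₁; inj₂)
open import Algebra.Definitions.RawSemiring ℚ.+-*-rawSemiring using () renaming (_^_ to _^ℚ_)
open import Function using (_∘_; id)
open import Relation.Binary.Definitions using (DecidableEquality; Symmetric)
open import Relation.Binary.PropositionalEquality
open import Relation.Binary.PropositionalEquality.Properties using (setoid)
open import Relation.Nullary using (¬_; Dec; yes; no; contradiction)
open import Relation.Nullary.Decidable using (¬?; _⊎-dec_; _×-dec_; map′)
open import Relation.Unary using (Decidable)

-- Weighted sums over sublists

𝟙 : {P : Set} → Dec P → ℕ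
𝟙 (yes _) = 1
𝟙 (no _)  = 0

𝟙≤1 : {P : Set} (p? : Dec P) → 𝟙 p? ≤ 1
𝟙≤1 (yes _) = ≤-refl
𝟙≤1 (no _)  = z≤n

𝟙-mono : {P Q : Set} (p? : Dec P) (q? : Dec Q) → (P → Q) → 𝟙 p? ≤ 𝟙 q?
𝟙-mono (no _)  q?      f = z≤n
𝟙-mono (yes p) (yes q) f = ≤-refl
𝟙-mono (yes p) (no ¬q) f = contradiction (f p) ¬q

𝟙-yes : {P : Set} (p? : Dec P) → P → 1 ≤ 𝟙 p?
𝟙-yes (yes _) p = ≤-refl
𝟙-yes (no ¬p) p = contradiction p ¬p

𝟙-no : {P : Set} (p? : Dec P) → ¬ P → 𝟙 p? ≡ 0
𝟙-no (yes p) ¬p = contradiction p ¬p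
𝟙-no (no _)  ¬p = refl

sum-𝟙 : {A : Set} {P : A → Set} (P? : Decidable P) (xs : List A) →
        sum (map (𝟙 ∘ P?) xs) ≡ length (filter P? xs)
sum-𝟙 P? []       = refl
sum-𝟙 P? (x ∷ xs) with P? x
... | yes _ = cong suc (sum-𝟙 P? xs)
... | no _  = sum-𝟙 P? xs

sum-+ : {A : Set} (f g : A → ℕ) (xs : List A) →
        sum (map (λ x → f x + g x) xs) ≡ sum (map f xs) + sum (map g xs)
sum-+ f g []       = refl
sum-+ f g (x ∷ xs) rewrite sum-+ f g xs =
  rearrange (f x) (g x) (sum (map f xs)) (sum (map g xs))
  where
  rearrange : ∀ a b c d → (a + b) + (c + d) ≡ (a + c) + (b + d)
  rearrange = solve-∀

sum-*ˡ : {A : Set} (c : ℕ) (f : A → ℕ) (xs : List A) →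
         sum (map (λ x → c * f x) xs) ≡ c * sum (map f xs)
sum-*ˡ c f []       = sym (*-zeroʳ c)
sum-*ˡ c f (x ∷ xs) rewrite sum-*ˡ c f xs = sym (*-distribˡ-+ c (f x) _)

filter-split : {A : Set} {P : A → Set} (P? : Decidable P) (xs : List A) →
               xs ↭ filter (¬? ∘ P?) xs ++ filter P? xs
filter-split P? []       = ↭-refl
filter-split P? (x ∷ xs) with P? x
... | yes _ = ↭-trans (prep x (filter-split P? xs))
                (↭-sym (Perm.shift x (filter (¬? ∘ P?) xs) (filter P? xs)))
... | no _  = prep x (filter-split P? xs)

module SubsetSum (M : ℕ) {V : Set} where

  -- ∑ xs φ is the sum of M ^ (length xs ∸ length I) * φ I over all I ⊆ xs, so
  -- that up to the factor M ^ length xs each element has fugacity 1 / M.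
  ∑ : List V → (List V → ℕ) → ℕ
  ∑ []       φ = φ []
  ∑ (x ∷ xs) φ = M * ∑ xs φ + ∑ xs (φ ∘ (x ∷_))

  ∑-mono : ∀ xs {φ ψ} → (∀ {I} → I ⊆ xs → φ I ≤ ψ I) → ∑ xs φ ≤ ∑ xs ψ
  ∑-mono []       h = h []
  ∑-mono (x ∷ xs) h = +-mono-≤ (*-monoʳ-≤ M (∑-mono xs (h ∘ (x ∷ʳ_))))
                               (∑-mono xs (h ∘ (refl ∷_)))

  ∑-cong : ∀ xs {φ ψ} → (∀ {I} → I ⊆ xs → φ I ≡ ψ I) → ∑ xs φ ≡ ∑ xs ψ
  ∑-cong xs h = ≤-antisym (∑-mono xs (≤-reflexive ∘ h))
                          (∑-mono xs (≤-reflexive ∘ sym ∘ h))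

  ∑-+ : ∀ xs φ ψ → ∑ xs (λ I → φ I + ψ I) ≡ ∑ xs φ + ∑ xs ψ
  ∑-+ []       φ ψ = refl
  ∑-+ (x ∷ xs) φ ψ rewrite ∑-+ xs φ ψ | ∑-+ xs (φ ∘ (x ∷_)) (ψ ∘ (x ∷_)) =
    rearrange M (∑ xs φ) (∑ xs ψ) (∑ xs (φ ∘ (x ∷_))) (∑ xs (ψ ∘ (x ∷_)))
    where
    rearrange : ∀ m a b c d → m * (a + b) + (c + d) ≡ (m * a + c) + (m * b + d)
    rearrange = solve-∀

  ∑-*ˡ : ∀ xs c φ → ∑ xs (λ I → c * φ I) ≡ c * ∑ xs φ
  ∑-*ˡ []       c φ = refl
  ∑-*ˡ (x ∷ xs) c φ rewrite ∑-*ˡ xs c φ | ∑-*ˡ xs c (φ ∘ (x ∷_)) =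
    rearrange M c (∑ xs φ) (∑ xs (φ ∘ (x ∷_)))
    where
    rearrange : ∀ m c a b → m * (c * a) + c * b ≡ c * (m * a + b)
    rearrange = solve-∀

  ∑-const : ∀ xs c → ∑ xs (λ _ → c) ≡ suc M ^ length xs * c
  ∑-const []       c = sym (+-identityʳ c)
  ∑-const (x ∷ xs) c rewrite ∑-const xs c = rearrange M (suc M ^ length xs) c
    where
    rearrange : ∀ m p c → m * (p * c) + p * c ≡ (p + m * p) * c
    rearrange = solve-∀

  ∑-++ : ∀ xs ys φ → ∑ (xs ++ ys) φ ≡ ∑ xs (λ I → ∑ ys (λ J → φ (I ++ J)))
  ∑-++ []       ys φ = refl
  ∑-++ (x ∷ xs) ys φ = cong₂ (λ a b → M * a + b) (∑-++ xs ys φ) (∑-++ xs ys (φ ∘ (x ∷_)))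

  -- `∑` builds each I in the order of the list, so reordering requires a summand that ignores
  -- order. It lets a chosen vertex and its neighbourhood be moved into position.
  ∑-↭ : ∀ {xs ys φ} → (∀ {I J} → I ↭ J → φ I ≡ φ J) → xs ↭ ys → ∑ xs φ ≡ ∑ ys φ
  ∑-↭ resp Perm.refl = refl
  ∑-↭ resp (prep x p) =
    cong₂ (λ a b → M * a + b) (∑-↭ resp p) (∑-↭ (resp ∘ prep x) p)
  ∑-↭ {φ = φ} resp (swap {xs} {ys} x y p) = begin
    M * (M * ∑ xs φ + ∑ xs (φ ∘ (y ∷_))) +
    (M * ∑ xs (φ ∘ (x ∷_)) + ∑ xs (φ ∘ (x ∷_) ∘ (y ∷_)))
      ≡⟨ cong₂ (λ a b → M * (M * a + b) + _) (∑-↭ resp p) (∑-↭ (resp ∘ prep y) p) ⟩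
    M * (M * ∑ ys φ + ∑ ys (φ ∘ (y ∷_))) +
    (M * ∑ xs (φ ∘ (x ∷_)) + ∑ xs (φ ∘ (x ∷_) ∘ (y ∷_)))
      ≡⟨ cong₂ (λ a b → M * (M * ∑ ys φ + ∑ ys (φ ∘ (y ∷_))) + (M * a + b))
           (∑-↭ (resp ∘ prep x) p)
           (trans (∑-↭ (resp ∘ prep x ∘ prep y) p)
                  (∑-cong ys λ _ → resp (swap x y ↭-refl))) ⟩
    M * (M * ∑ ys φ + ∑ ys (φ ∘ (y ∷_))) +
    (M * ∑ ys (φ ∘ (x ∷_)) + ∑ ys (φ ∘ (y ∷_) ∘ (x ∷_)))
      ≡⟨ rearrange M (∑ ys φ) _ _ _ ⟩
    M * (M * ∑ ys φ + ∑ ys (φ ∘ (x ∷_))) +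
    (M * ∑ ys (φ ∘ (y ∷_)) + ∑ ys (φ ∘ (y ∷_) ∘ (x ∷_))) ∎
    where
    open ≡-Reasoning
    rearrange : ∀ m a b c d → m * (m * a + b) + (m * c + d) ≡ m * (m * a + c) + (m * b + d)
    rearrange = solve-∀
  ∑-↭ resp (Perm.trans p q) = trans (∑-↭ resp p) (∑-↭ resp q)

  ∑-empty-≤ : ∀ xs φ → M ^ length xs * φ [] ≤ ∑ xs φ
  ∑-empty-≤ []       φ = ≤-reflexive (+-identityʳ _)
  ∑-empty-≤ (x ∷ xs) φ = begin
    M * M ^ length xs * φ []   ≡⟨ *-assoc M _ _ ⟩
    M * (M ^ length xs * φ []) ≤⟨ *-monoʳ-≤ M (∑-empty-≤ xs φ) ⟩
    M * ∑ xs φ                 ≤⟨ m≤m+n _ _ ⟩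
    ∑ (x ∷ xs) φ               ∎
    where open ≤-Reasoning

  ∑-zero : ∀ xs {φ} → (∀ {I} → I ⊆ xs → φ I ≡ 0) → ∑ xs φ ≡ 0
  ∑-zero xs h = trans (∑-cong xs h) (trans (∑-const xs 0) (*-zeroʳ (suc M ^ length xs)))

  ∑-empty : ∀ xs {φ} → (∀ {x I} → x ∈ xs → φ (x ∷ I) ≡ 0) →
            ∑ xs φ ≡ M ^ length xs * φ []
  ∑-empty []       h = sym (+-identityʳ _)
  ∑-empty (x ∷ xs) {φ} h = begin
    M * ∑ xs φ + ∑ xs (φ ∘ (x ∷_)) ≡⟨ cong₂ (λ a b → M * a + b) (∑-empty xs (h ∘ there))
                                        (∑-zero xs λ _ → h (here refl)) ⟩
    M * (M ^ length xs * φ []) + 0 ≡⟨ +-identityʳ _ ⟩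
    M * (M ^ length xs * φ [])     ≡⟨ *-assoc M _ _ ⟨
    M * M ^ length xs * φ []       ∎
    where open ≡-Reasoning

  module _ {P : V → Set} (P? : Decidable P) where

    -- Only those I that avoid every element failing `P?` are kept; each avoided element contributes
    -- a factor `M`.
    ∑-filter-≤ : ∀ xs φ →
      M ^ length (filter (¬? ∘ P?) xs) * ∑ (filter P? xs) φ ≤ ∑ xs φ
    ∑-filter-≤ []       φ = ≤-reflexive (+-identityʳ _)
    ∑-filter-≤ (x ∷ xs) φ with P? x
    ... | no _  = begin
      M * M ^ c * ∑ ys φ   ≡⟨ *-assoc M _ _ ⟩
      M * (M ^ c * ∑ ys φ) ≤⟨ *-monoʳ-≤ M (∑-filter-≤ xs φ) ⟩
      M * ∑ xs φ           ≤⟨ m≤m+n _ _ ⟩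
      ∑ (x ∷ xs) φ         ∎
      where
      open ≤-Reasoning
      c  = length (filter (¬? ∘ P?) xs)
      ys = filter P? xs
    ... | yes _ = begin
      M ^ c * (M * ∑ ys φ + ∑ ys (φ ∘ (x ∷_)))
        ≡⟨ rearrange (M ^ c) M _ _ ⟩
      M * (M ^ c * ∑ ys φ) + M ^ c * ∑ ys (φ ∘ (x ∷_))
        ≤⟨ +-mono-≤ (*-monoʳ-≤ M (∑-filter-≤ xs φ)) (∑-filter-≤ xs (φ ∘ (x ∷_))) ⟩
      ∑ (x ∷ xs) φ ∎
      where
      open ≤-Reasoning
      c  = length (filter (¬? ∘ P?) xs)
      ys = filter P? xs
      rearrange : ∀ p m a b → p * (m * a + b) ≡ m * (p * a) + p * b
      rearrange = solve-∀

    -- The sets discarded in `∑-filter-≤` now contribute 0, so nothing is lost.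
    ∑-filter-≥ : ∀ xs {φ} → (∀ {x I} → x ∈ I → ¬ P x → φ I ≡ 0) →
      ∑ xs φ ≤ M ^ length (filter (¬? ∘ P?) xs) * ∑ (filter P? xs) φ
    ∑-filter-≥ []       h = ≤-reflexive (sym (+-identityʳ _))
    ∑-filter-≥ (x ∷ xs) {φ} h with P? x
    ... | no ¬p = begin
      M * ∑ xs φ + ∑ xs (φ ∘ (x ∷_))
        ≡⟨ cong (M * ∑ xs φ +_) (∑-zero xs λ _ → h (here refl) ¬p) ⟩
      M * ∑ xs φ + 0       ≡⟨ +-identityʳ _ ⟩
      M * ∑ xs φ           ≤⟨ *-monoʳ-≤ M (∑-filter-≥ xs h) ⟩
      M * (M ^ c * ∑ ys φ) ≡⟨ *-assoc M _ _ ⟨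
      M * M ^ c * ∑ ys φ   ∎
      where
      open ≤-Reasoning
      c  = length (filter (¬? ∘ P?) xs)
      ys = filter P? xs
    ... | yes _ = begin
      ∑ (x ∷ xs) φ
        ≤⟨ +-mono-≤ (*-monoʳ-≤ M (∑-filter-≥ xs h)) (∑-filter-≥ xs (h ∘ there)) ⟩
      M * (M ^ c * ∑ ys φ) + M ^ c * ∑ ys (φ ∘ (x ∷_))
        ≡⟨ rearrange (M ^ c) M _ _ ⟨
      M ^ c * (M * ∑ ys φ + ∑ ys (φ ∘ (x ∷_))) ∎
      where
      open ≤-Reasoning
      c  = length (filter (¬? ∘ P?) xs)
      ys = filter P? xs
      rearrange : ∀ p m a b → p * (m * a + b) ≡ m * (p * a) + p * b
      rearrange = solve-∀

-- Independent sets of locally sparse graphs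

-- The inductive form of (1 + 1/M) ^ t * (1 - t/M) ≤ 1.
suc^-linear : ∀ M t → suc M ^ t * M ≤ M ^ suc t + t * suc M ^ t
suc^-linear M zero    = ≤-reflexive (rearrange M)
  where
  rearrange : ∀ m → 1 * m ≡ m * 1 + 0 * 1
  rearrange = solve-∀
suc^-linear M (suc t) = begin
  suc M * suc M ^ t * M                        ≡⟨ *-assoc (suc M) (suc M ^ t) M ⟩
  suc M * (suc M ^ t * M)                      ≤⟨ *-monoʳ-≤ (suc M) (suc^-linear M t) ⟩
  suc M * (M ^ suc t + t * suc M ^ t)          ≡⟨ rearrange M (M ^ suc t) t (suc M ^ t) ⟩
  M * M ^ suc t + (M ^ suc t + t * (suc M * suc M ^ t))
    ≤⟨ +-monoʳ-≤ (M * M ^ suc t) (+-monoˡ-≤ _ (^-monoˡ-≤ (suc t) (n≤1+n M))) ⟩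
  M ^ suc (suc t) + suc t * suc M ^ suc t      ∎
  where
  open ≤-Reasoning
  rearrange : ∀ m p t q → (1 + m) * (p + t * q) ≡ m * p + (p + t * ((1 + m) * q))
  rearrange = solve-∀

-- With M = 2h and t ≤ h the factor 1 - t/M of `suc^-linear` is at least 1/2. Subtraction is avoided
-- by adding `M * suc M ^ t` to both sides; it absorbs the error term as 2t ≤ M.
suc^≤2*^ : ∀ h t .{{_ : NonZero h}} → t ≤ h → suc (2 * h) ^ t ≤ 2 * (2 * h) ^ t
suc^≤2*^ h t t≤h = *-cancelʳ-≤ (suc M ^ t) (2 * M ^ t) M {{m*n≢0 2 h}} (+-cancelʳ-≤ (M * suc M ^ t) _ _ (begin
  suc M ^ t * M + M * suc M ^ t        ≡⟨ rearrange₁ M (suc M ^ t) ⟩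
  2 * (suc M ^ t * M)                  ≤⟨ *-monoʳ-≤ 2 (suc^-linear M t) ⟩
  2 * (M ^ suc t + t * suc M ^ t)      ≡⟨ rearrange₂ (M ^ t) M t (suc M ^ t) ⟩
  2 * M ^ t * M + 2 * t * suc M ^ t    ≤⟨ +-monoʳ-≤ (2 * M ^ t * M) (*-monoˡ-≤ _ (*-monoʳ-≤ 2 t≤h)) ⟩
  2 * M ^ t * M + M * suc M ^ t        ∎))
  where
  open ≤-Reasoning
  M = 2 * h
  rearrange₁ : ∀ m p → p * m + m * p ≡ 2 * (p * m)
  rearrange₁ = solve-∀
  rearrange₂ : ∀ p m t q → 2 * (m * p + t * q) ≡ 2 * p * m + 2 * t * q
  rearrange₂ = solve-∀

-- The exponent b splits into at most k blocks of length at most h, each costing a factor 2.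
suc^≤2^*^ : ∀ h k b .{{_ : NonZero h}} → b ≤ k * h → suc (2 * h) ^ b ≤ 2 ^ k * (2 * h) ^ b
suc^≤2^*^ h zero    zero le = ≤-refl
suc^≤2^*^ h (suc k) b le with ≤-total b h
... | inj₁ b≤h = begin
  suc (2 * h) ^ b           ≤⟨ suc^≤2*^ h b b≤h ⟩
  2 * (2 * h) ^ b           ≤⟨ *-monoˡ-≤ _ (^-monoʳ-≤ 2 (s≤s (z≤n {k}))) ⟩
  2 ^ suc k * (2 * h) ^ b   ∎
  where
  open ≤-Reasoning
... | inj₂ h≤b = begin
  suc (2 * h) ^ b                                  ≡⟨ cong (suc (2 * h) ^_) (m+[n∸m]≡n h≤b) ⟨
  suc (2 * h) ^ (h + c)                            ≡⟨ ^-distribˡ-+-* (suc (2 * h)) h c ⟩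
  suc (2 * h) ^ h * suc (2 * h) ^ c                ≤⟨ *-mono-≤ (suc^≤2*^ h h ≤-refl) (suc^≤2^*^ h k c c≤) ⟩
  2 * (2 * h) ^ h * (2 ^ k * (2 * h) ^ c)          ≡⟨ rearrange ((2 * h) ^ h) (2 ^ k) ((2 * h) ^ c) ⟩
  2 ^ suc k * ((2 * h) ^ h * (2 * h) ^ c)          ≡⟨ cong (2 ^ suc k *_) (^-distribˡ-+-* (2 * h) h c) ⟨
  2 ^ suc k * (2 * h) ^ (h + c)                    ≡⟨ cong (λ b → 2 ^ suc k * (2 * h) ^ b) (m+[n∸m]≡n h≤b) ⟩
  2 ^ suc k * (2 * h) ^ b                          ∎
  where
  open ≤-Reasoning
  c = b ∸ h
  c≤ : c ≤ k * h
  c≤ = ≤-trans (∸-monoˡ-≤ h le) (≤-reflexive (m+n∸m≡n h (k * h)))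
  rearrange : ∀ p k q → 2 * p * (k * q) ≡ 2 * k * (p * q)
  rearrange = solve-∀

AllPairs-++⁻ˡ : {A : Set} {R : A → A → Set} (xs : List A) {ys : List A} →
                AllPairs R (xs ++ ys) → AllPairs R xs
AllPairs-++⁻ˡ []       _        = []
AllPairs-++⁻ˡ (x ∷ xs) (r ∷ rs) = All.++⁻ˡ xs r ∷ AllPairs-++⁻ˡ xs rs

AllPairs-++⁻ʳ : {A : Set} {R : A → A → Set} (xs : List A) {ys : List A} →
                AllPairs R (xs ++ ys) → AllPairs R ys
AllPairs-++⁻ʳ []       rs       = rs
AllPairs-++⁻ʳ (x ∷ xs) (_ ∷ rs) = AllPairs-++⁻ʳ xs rs

AllPairs-cross : {A : Set} {R : A → A → Set} (xs : List A) {ys : List A} {y : A} →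
                 AllPairs R (xs ++ ys) → y ∈ ys → All (λ x → R x y) xs
AllPairs-cross []       _        _    = []
AllPairs-cross (x ∷ xs) (r ∷ rs) y∈ys =
  All.lookup r (∈-++⁺ʳ xs y∈ys) ∷ AllPairs-cross xs rs y∈ys

AllPairs-resp-↭ : {A : Set} {R : A → A → Set} → Symmetric R → ∀ {xs ys} →
                  xs ↭ ys → AllPairs R xs → AllPairs R ys
AllPairs-resp-↭ {A} {R} R-sym p =
  PermSetoid.AllPairs-resp-↭ (setoid A) R-sym (resp₂ R) (↭⇒↭ₛ p)

∈⇒↭ : {A : Set} {x : A} {xs : List A} → x ∈ xs → ∃[ ys ] xs ↭ x ∷ ys
∈⇒↭ x∈xs with ∈-∃++ x∈xs
... | ys , zs , refl = ys ++ zs , Perm.shift _ ys zs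

module Independence {V : Set} (_≟_ : DecidableEquality V)
                    {E : V → V → Set} (E? : ∀ u v → Dec (E u v)) (E-sym : Symmetric E) where

  Indep : List V → Set
  Indep = AllPairs (λ u v → ¬ E u v)

  ¬E-sym : ∀ {u v} → ¬ E u v → ¬ E v u
  ¬E-sym ¬e = ¬e ∘ E-sym

  indep? : Decidable Indep
  indep? = AllPairs.allPairs? (λ u v → ¬? (E? u v))

  χ : List V → ℕ
  χ I = 𝟙 (indep? I)

  χ-mono : ∀ {I J} → (Indep I → Indep J) → χ I ≤ χ J
  χ-mono {I} {J} = 𝟙-mono (indep? I) (indep? J)

  χ-↭ : ∀ {I J} → I ↭ J → χ I ≡ χ J
  χ-↭ p = ≤-antisym (χ-mono (AllPairs-resp-↭ ¬E-sym p))
                    (χ-mono (AllPairs-resp-↭ ¬E-sym (↭-sym p)))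

  degree : V → List V → ℕ
  degree u xs = length (filter (E? u) xs)

  degree-⊆ : ∀ u {xs ys} → xs ⊆ ys → degree u xs ≤ degree u ys
  degree-⊆ u s = Sublist.length-mono-≤ (Sublist.filter⁺ (E? u) (E? u) (λ { refl e → e }) s)

  -- Written as a sum over `I` so that occupation of a vertex is a special case of the weights in
  -- `weighted-↭` and `∑-weighted`.
  hits : V → List V → ℕ
  hits u I = sum (map (λ w → 𝟙 (w ≟ u)) I)

  module HardCore (M : ℕ) where
    open SubsetSum M {V}

    -- The partition function of the hard-core model at fugacity 1/M, cleared of denominators. Means
    -- are expressed as inequalities between `Z` times a constant and weighted sums.
    Z : List V → ℕ
    Z xs = ∑ xs χ

    Z-++ : ∀ xs ys → Z (xs ++ ys) ≤ suc M ^ length xs * Z ys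
    Z-++ xs ys = begin
      Z (xs ++ ys)                         ≡⟨ ∑-++ xs ys χ ⟩
      ∑ xs (λ I → ∑ ys (λ J → χ (I ++ J))) ≤⟨ ∑-mono xs (λ {I} _ → ∑-mono ys λ _ → χ-mono (AllPairs-++⁻ʳ I)) ⟩
      ∑ xs (λ _ → Z ys)                    ≡⟨ ∑-const xs (Z ys) ⟩
      suc M ^ length xs * Z ys             ∎
      where open ≤-Reasoning

    Z≤ : ∀ xs → Z xs ≤ suc M ^ length xs
    Z≤ xs = begin
      Z xs                    ≤⟨ ∑-mono xs (λ {I} _ → 𝟙≤1 (indep? I)) ⟩
      ∑ xs (λ _ → 1)          ≡⟨ ∑-const xs 1 ⟩
      suc M ^ length xs * 1   ≡⟨ *-identityʳ _ ⟩
      suc M ^ length xs       ∎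
      where open ≤-Reasoning

    weighted-↭ : ∀ h {I J} → I ↭ J → χ I * sum (map h I) ≡ χ J * sum (map h J)
    weighted-↭ h p = cong₂ _*_ (χ-↭ p) (sum-↭ (Perm.map⁺ h p))

    -- Linearity of expectation. In its uses `z` is `Z xs` times a lower bound for the mean weight
    -- seen from a single vertex.
    ∑-weighted : ∀ {z} (h : V → V → ℕ) xs us →
      (∀ {v} → v ∈ us → z ≤ ∑ xs (λ I → χ I * sum (map (h v) I))) →
      length us * z ≤ ∑ xs (λ I → χ I * sum (map (λ v → sum (map (h v) I)) us))
    ∑-weighted h xs []       le = z≤n
    ∑-weighted {z} h xs (u ∷ us) le = begin
      z + length us * z
        ≤⟨ +-mono-≤ (le (here refl)) (∑-weighted h xs us (le ∘ there)) ⟩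
      ∑ xs (λ I → χ I * X u I) + ∑ xs (λ I → χ I * sum (map (λ v → X v I) us))
        ≡⟨ ∑-+ xs _ _ ⟨
      ∑ xs (λ I → χ I * X u I + χ I * sum (map (λ v → X v I) us))
        ≡⟨ ∑-cong xs (λ {I} _ → sym (*-distribˡ-+ (χ I) _ _)) ⟩
      ∑ xs (λ I → χ I * (X u I + sum (map (λ v → X v I) us))) ∎
      where
      open ≤-Reasoning
      X : V → List V → ℕ
      X v I = sum (map (h v) I)

  -- The order of summation is exchanged: each member of `I` then receives total weight at most c.
  double-count : ∀ {c} (h : V → V → ℕ) us {I} →
    (∀ {w} → w ∈ I → sum (map (λ v → h v w) us) ≤ c) →
    sum (map (λ v → sum (map (h v) I)) us) ≤ c * length I
  double-count h us {[]}    le = ≤-trans (≤-reflexive (zeros us)) z≤n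
    where
    zeros : ∀ us → sum (map (λ (_ : V) → 0) us) ≡ 0
    zeros []       = refl
    zeros (_ ∷ us) = zeros us
  double-count {c} h us {w ∷ I} le = begin
    sum (map (λ v → h v w + sum (map (h v) I)) us)
      ≡⟨ sum-+ (λ v → h v w) (λ v → sum (map (h v) I)) us ⟩
    sum (map (λ v → h v w) us) + sum (map (λ v → sum (map (h v) I)) us)
      ≤⟨ +-mono-≤ (le (here refl)) (double-count h us (le ∘ there)) ⟩
    c + c * length I
      ≡⟨ *-suc c (length I) ⟨
    c * suc (length I) ∎
    where open ≤-Reasoning

  equals≤1 : ∀ {us} w → Unique us → sum (map (λ v → 𝟙 (w ≟ v)) us) ≤ 1
  equals≤1 {us} w uq rewrite sum-𝟙 (w ≟_) us =
    go (AllPairs.filter⁺ (w ≟_) uq) (All.all-filter (w ≟_) us)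
    where
    go : ∀ {ys} → Unique ys → All (w ≡_) ys → length ys ≤ 1
    go []                        _                 = z≤n
    go ([] ∷ _)                  _                 = ≤-refl
    go ((x≢y ∷ _) ∷ _) (refl ∷ refl ∷ _) = contradiction refl x≢y

  module Local (s : ℕ) where
    -- Here `s` bounds degrees inside a neighbourhood. A closed neighbourhood there has at most s +
    -- 1 vertices, so with this M all its subsets together weigh at most twice the empty one.
    M : ℕ
    M = 2 * suc s

    open SubsetSum M {V}
    open HardCore M

    -- Given the restriction to the non-neighbours R of u, the closed neighbourhood of u has
    -- relative weight at most (1 + 1/M)^(s+1) ≤ 2, while u alone is always admissible with relative
    -- weight 1/M. Hence u is occupied with probability at least 1/(2M).
    occupancy : ∀ {B u} → u ∈ B → degree u B ≤ s →
                Z B ≤ 2 * M * ∑ B (λ I → χ I * hits u I)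
    occupancy {B} {u} u∈B deg with ∈⇒↭ u∈B
    ... | B′ , B↭ = begin
      Z B                                  ≡⟨ ∑-↭ χ-↭ p ⟩
      Z ((u ∷ N) ++ R)                     ≤⟨ Z-++ (u ∷ N) R ⟩
      suc M ^ suc (length N) * Z R         ≤⟨ *-monoˡ-≤ (Z R) (suc^≤2*^ (suc s) (suc (length N)) (s≤s N≤s)) ⟩
      2 * (M * M ^ length N) * Z R         ≡⟨ rearrange M (M ^ length N) (Z R) ⟩
      2 * M * (M ^ length N * Z R)         ≤⟨ *-monoʳ-≤ (2 * M) lower ⟩
      2 * M * ∑ B ψ                        ∎
      where
      open ≤-Reasoning
      N = filter (E? u) B′
      R = filter (¬? ∘ E? u) B′
      ψ : List V → ℕ
      ψ I = χ I * hits u I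
      p : B ↭ u ∷ N ++ R
      p = ↭-trans B↭ (prep u (↭-trans (filter-split (E? u) B′) (Perm.++-comm R N)))
      N≤s : length N ≤ s
      N≤s = begin
        degree u B′       ≤⟨ degree-⊆ u (u ∷ʳ Sublist.⊆-refl) ⟩
        degree u (u ∷ B′) ≡⟨ Perm.↭-length (Perm.filter-↭ (E? u) (↭-sym B↭)) ⟩
        degree u B        ≤⟨ deg ⟩
        s                 ∎
      occupied : ∀ {J} → J ⊆ R → χ J ≤ ψ (u ∷ J)
      occupied {J} J⊆R = begin
        χ J                 ≤⟨ χ-mono (Sublist.All-resp-⊆ J⊆R (All.all-filter (¬? ∘ E? u) B′) ∷_) ⟩
        χ (u ∷ J)           ≡⟨ *-identityʳ _ ⟨
        χ (u ∷ J) * 1       ≤⟨ *-monoʳ-≤ (χ (u ∷ J)) (≤-trans (𝟙-yes (u ≟ u) refl) (m≤m+n _ _)) ⟩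
        ψ (u ∷ J)           ∎
      lower : M ^ length N * Z R ≤ ∑ B ψ
      lower = begin
        M ^ length N * Z R
          ≤⟨ *-monoʳ-≤ (M ^ length N) (∑-mono R occupied) ⟩
        M ^ length N * ∑ R (λ J → ψ (u ∷ J))
          -- Among the sets containing u, those meeting N are dropped.
          ≤⟨ ∑-empty-≤ N (λ K → ∑ R (λ J → ψ (u ∷ K ++ J))) ⟩
        ∑ N (λ K → ∑ R (λ J → ψ (u ∷ K ++ J)))
          ≡⟨ ∑-++ N R (ψ ∘ (u ∷_)) ⟨
        ∑ (N ++ R) (ψ ∘ (u ∷_))
          ≤⟨ m≤n+m _ (M * ∑ (N ++ R) ψ) ⟩
        ∑ (u ∷ N ++ R) ψ
          ≡⟨ ∑-↭ (weighted-↭ _) p ⟨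
        ∑ B ψ ∎
      rearrange : ∀ m p z → 2 * (m * p) * z ≡ 2 * m * (p * z)
      rearrange = solve-∀

    -- `occupancy` is summed over B. The factor 2M is moved into the weights so that each member of
    -- `I` is counted with weight at most 2M.
    mean-size : ∀ {B} → Unique B → (∀ {u} → u ∈ B → degree u B ≤ s) →
                length B * Z B ≤ 2 * M * ∑ B (λ I → χ I * length I)
    mean-size {B} uq deg = begin
      length B * Z B
        ≤⟨ ∑-weighted (λ u w → 2 * M * 𝟙 (w ≟ u)) B B occ ⟩
      ∑ B (λ I → χ I * sum (map (λ u → sum (map (λ w → 2 * M * 𝟙 (w ≟ u)) I)) B))
        ≤⟨ ∑-mono B (λ {I} _ → *-monoʳ-≤ (χ I) (double-count _ B {I} λ {w} _ → bound w)) ⟩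
      ∑ B (λ I → χ I * (2 * M * length I))
        ≡⟨ ∑-cong B (λ {I} _ → rearrange (χ I) (2 * M) (length I)) ⟩
      ∑ B (λ I → 2 * M * (χ I * length I))
        ≡⟨ ∑-*ˡ B (2 * M) _ ⟩
      2 * M * ∑ B (λ I → χ I * length I) ∎
      where
      open ≤-Reasoning
      rearrange : ∀ a b c → a * (b * c) ≡ b * (a * c)
      rearrange = solve-∀
      occ : ∀ {u} → u ∈ B → Z B ≤ ∑ B (λ I → χ I * sum (map (λ w → 2 * M * 𝟙 (w ≟ u)) I))
      occ {u} u∈B = begin
        Z B                                  ≤⟨ occupancy u∈B (deg u∈B) ⟩
        2 * M * ∑ B (λ I → χ I * hits u I)   ≡⟨ ∑-*ˡ B (2 * M) _ ⟨
        ∑ B (λ I → 2 * M * (χ I * hits u I)) ≡⟨ ∑-cong B (λ {I} _ → trans (rearrange (2 * M) (χ I) _)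
                                                  (cong (χ I *_) (sym (sum-*ˡ (2 * M) _ I)))) ⟩
        ∑ B (λ I → χ I * sum (map (λ w → 2 * M * 𝟙 (w ≟ u)) I)) ∎
      bound : ∀ w → sum (map (λ u → 2 * M * 𝟙 (w ≟ u)) B) ≤ 2 * M
      bound w = begin
        sum (map (λ u → 2 * M * 𝟙 (w ≟ u)) B) ≡⟨ sum-*ˡ (2 * M) _ B ⟩
        2 * M * sum (map (λ u → 𝟙 (w ≟ u)) B) ≤⟨ *-monoʳ-≤ (2 * M) (equals≤1 w uq) ⟩
        2 * M * 1                             ≡⟨ *-identityʳ _ ⟩
        2 * M                                 ∎

    -- If Z B is small, the occupied centre of the neighbourhood (the summand d)
    -- suffices; otherwise B is large, hence so is the mean size of I ⊆ B.
    neighbourhood : ∀ {B d} ℓ → ℓ * (M * 16 ^ ℓ + 1) ≤ d → Unique B →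
      (∀ {u} → u ∈ B → degree u B ≤ s) →
      ℓ * (M * Z B + M ^ length B) ≤
      M * ∑ B (λ I → χ I * length I) + M ^ length B * d
    -- At the threshold 4ℓ(s+1) = 2Mℓ both cases meet: below it Z B is at most 2^(4ℓ) = 16^ℓ times
    -- the weight of the empty set, above it `mean-size` gives mean at least ℓ.
    neighbourhood {B} {d} ℓ ℓ≤d uq deg with ≤-total (length B) (4 * ℓ * suc s)
    ... | inj₁ small = begin
      ℓ * (M * Z B + M ^ length B)               ≤⟨ *-monoʳ-≤ ℓ (+-monoˡ-≤ _ (*-monoʳ-≤ M Z≤16^)) ⟩
      ℓ * (M * (16 ^ ℓ * M ^ length B) + M ^ length B)
                                                 ≡⟨ rearrange ℓ M (16 ^ ℓ) (M ^ length B) ⟩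
      M ^ length B * (ℓ * (M * 16 ^ ℓ + 1))      ≤⟨ *-monoʳ-≤ (M ^ length B) ℓ≤d ⟩
      M ^ length B * d                           ≤⟨ m≤n+m _ _ ⟩
      M * ∑ B (λ I → χ I * length I) + M ^ length B * d ∎
      where
      open ≤-Reasoning
      rearrange : ∀ l m e p → l * (m * (e * p) + p) ≡ p * (l * (m * e + 1))
      rearrange = solve-∀
      Z≤16^ : Z B ≤ 16 ^ ℓ * M ^ length B
      Z≤16^ = begin
        Z B                                ≤⟨ Z≤ B ⟩
        suc M ^ length B                   ≤⟨ suc^≤2^*^ (suc s) (4 * ℓ) (length B) small ⟩
        2 ^ (4 * ℓ) * M ^ length B         ≡⟨ cong (_* M ^ length B) (^-*-assoc 2 4 ℓ) ⟨
        16 ^ ℓ * M ^ length B              ∎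
    ... | inj₂ large = begin
      ℓ * (M * Z B + M ^ length B)               ≡⟨ rearrange ℓ M (Z B) (M ^ length B) ⟩
      M * (ℓ * Z B) + M ^ length B * ℓ           ≤⟨ +-mono-≤ (*-monoʳ-≤ M ℓZ≤) (*-monoʳ-≤ (M ^ length B) ℓ≤) ⟩
      M * ∑ B (λ I → χ I * length I) + M ^ length B * d ∎
      where
      open ≤-Reasoning
      rearrange : ∀ l m z p → l * (m * z + p) ≡ m * (l * z) + p * l
      rearrange = solve-∀
      rearrange′ : ∀ l s z → 2 * (2 * (1 + s)) * (l * z) ≡ 4 * l * (1 + s) * z
      rearrange′ = solve-∀
      ℓ≤ : ℓ ≤ d
      ℓ≤ = begin
        ℓ                        ≡⟨ *-identityʳ ℓ ⟨
        ℓ * 1                    ≤⟨ *-monoʳ-≤ ℓ (m≤n+m 1 (M * 16 ^ ℓ)) ⟩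
        ℓ * (M * 16 ^ ℓ + 1)     ≤⟨ ℓ≤d ⟩
        d                        ∎
      ℓZ≤ : ℓ * Z B ≤ ∑ B (λ I → χ I * length I)
      ℓZ≤ = *-cancelˡ-≤ (2 * M) (begin
        2 * M * (ℓ * Z B)                    ≡⟨ rearrange′ ℓ s (Z B) ⟩
        4 * ℓ * suc s * Z B                  ≤⟨ *-monoˡ-≤ (Z B) large ⟩
        length B * Z B                       ≤⟨ mean-size uq deg ⟩
        2 * M * ∑ B (λ I → χ I * length I)   ∎)

    -- `J` is the part of the random set among the non-neighbours of v. Given J, the rest is either
    -- v alone or an independent subset of `B`, the neighbours of v with no neighbour in J.
    module Conditional {v d ℓ ys} (ℓ≤d : ℓ * (M * 16 ^ ℓ + 1) ≤ d) (uq : Unique ys)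
      (codegree : ∀ {u} → u ∈ filter (E? v) ys → degree u (filter (E? v) ys) ≤ s)
      {J} (J⊆O : J ⊆ filter (¬? ∘ E? v) ys) (indep : Indep J) where

      A : List V
      A = filter (E? v) ys

      -- The centre counts d and each of its neighbours 1. Summed over all centres v, a fixed w of
      -- degree at most d then gets at most 2d.
      h : V → ℕ
      h w = d * 𝟙 (w ≟ v) + 𝟙 (E? w v)

      ψ : List V → ℕ
      ψ I = χ I * sum (map h I)

      Free : V → Set
      Free u = All (λ w → ¬ E u w) J

      free? : Decidable Free
      free? u = All.all? (λ w → ¬? (E? u w)) J

      B : List V
      B = filter free? A

      c : ℕ
      c = length (filter (¬? ∘ free?) A)

      M^A : M ^ length A ≡ M ^ c * M ^ length B
      M^A = begin
        M ^ length A          ≡⟨ cong (M ^_) (Perm.↭-length (filter-split free? A)) ⟩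
        M ^ length (filter (¬? ∘ free?) A ++ B)
                              ≡⟨ cong (M ^_) (length-++ (filter (¬? ∘ free?) A)) ⟩
        M ^ (c + length B)    ≡⟨ ^-distribˡ-+-* M c (length B) ⟩
        M ^ c * M ^ length B  ∎
        where open ≡-Reasoning

      sum-++-≥ : ∀ K → sum (map h K) ≤ sum (map h (J ++ K))
      sum-++-≥ K rewrite map-++ h J K | sum-++ (map h J) (map h K) = m≤n+m _ _

      blocked : ∀ {x K} → x ∈ K → ¬ Free x → χ (J ++ K) ≡ 0
      blocked {x} {K} x∈K ¬free = 𝟙-no (indep? (J ++ K)) λ i →
        ¬free (All.map ¬E-sym (AllPairs-cross J i x∈K))

      -- If v is absent, K must be an independent subset of B, and the c blocked neighbours give the
      -- factor `M ^ c`; if v is present, no neighbour of v may be.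
      upper : ∑ (v ∷ A) (λ K → χ (J ++ K)) ≤ M ^ c * (M * Z B + M ^ length B)
      upper = begin
        M * ∑ A (λ K → χ (J ++ K)) + ∑ A (λ K → χ (J ++ v ∷ K))
          ≤⟨ +-mono-≤ (*-monoʳ-≤ M (∑-filter-≥ free? A blocked))
                      (≤-reflexive (∑-empty A λ {x} {I} x∈A →
                        𝟙-no (indep? (J ++ v ∷ x ∷ I)) (v-excludes x∈A ∘ AllPairs-++⁻ʳ J))) ⟩
        M * (M ^ c * ∑ B (λ K → χ (J ++ K))) + M ^ length A * χ (J ++ v ∷ [])
          ≤⟨ +-mono-≤ (*-monoʳ-≤ M (*-monoʳ-≤ (M ^ c) (∑-mono B λ _ → χ-mono (AllPairs-++⁻ʳ J))))
                      (*-mono-≤ (≤-reflexive M^A) (𝟙≤1 (indep? (J ++ v ∷ [])))) ⟩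
        M * (M ^ c * Z B) + M ^ c * M ^ length B * 1
          ≡⟨ rearrange M (M ^ c) (Z B) (M ^ length B) ⟩
        M ^ c * (M * Z B + M ^ length B) ∎
        where
        open ≤-Reasoning
        rearrange : ∀ m p z q → m * (p * z) + p * q * 1 ≡ p * (m * z + q)
        rearrange = solve-∀
        v-excludes : ∀ {x I} → x ∈ A → ¬ Indep (v ∷ x ∷ I)
        v-excludes x∈A ((¬e ∷ _) ∷ _) = ¬e (proj₂ (∈-filter⁻ (E? v) {xs = ys} x∈A))

      neighbours : ∀ {K} → K ⊆ B → χ K * length K ≤ ψ (J ++ K)
      neighbours {K} K⊆B = *-mono-≤ (χ-mono extend) (≤-trans (size adj) (sum-++-≥ K))
        where
        free : All Free K
        free = Sublist.All-resp-⊆ K⊆B (All.all-filter free? A)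
        adj : All (E v) K
        adj = Sublist.All-resp-⊆ (Sublist.⊆-trans K⊆B (Sublist.filter-⊆ free? A))
                                 (All.all-filter (E? v) ys)
        extend : Indep K → Indep (J ++ K)
        extend k = AllPairs.++⁺ indep k
          (All.tabulate λ w∈J → All.map (λ f → ¬E-sym (All.lookup f w∈J)) free)
        size : ∀ {K} → All (E v) K → length K ≤ sum (map h K)
        size []                = z≤n
        size (_∷_ {w} e es) = +-mono-≤ (≤-trans (𝟙-yes (E? w v) (E-sym e)) (m≤n+m _ _)) (size es)

      centre : d ≤ ψ (J ++ v ∷ [])
      centre = begin
        d                                          ≡⟨ *-identityˡ d ⟨
        1 * d                                      ≤⟨ *-mono-≤ (𝟙-yes (indep? (J ++ v ∷ [])) extend) d≤ ⟩
        χ (J ++ v ∷ []) * sum (map h (J ++ v ∷ [])) ∎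
        where
        open ≤-Reasoning
        extend : Indep (J ++ v ∷ [])
        extend = AllPairs.++⁺ indep ([] ∷ []) (All.map (λ ¬e → ¬E-sym ¬e ∷ [])
          (Sublist.All-resp-⊆ J⊆O (All.all-filter (¬? ∘ E? v) ys)))
        d≤ : d ≤ sum (map h (J ++ v ∷ []))
        d≤ = begin
          d                             ≡⟨ *-identityʳ d ⟨
          d * 1                         ≤⟨ *-monoʳ-≤ d (𝟙-yes (v ≟ v) refl) ⟩
          d * 𝟙 (v ≟ v)                 ≤⟨ m≤m+n _ _ ⟩
          h v                           ≤⟨ m≤m+n _ _ ⟩
          sum (map h (v ∷ []))          ≤⟨ sum-++-≥ (v ∷ []) ⟩
          sum (map h (J ++ v ∷ []))     ∎

      -- The same two cases as in `upper`, now weighted: a set K within B counts at least its size,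
      -- and v alone counts at least d.
      lower : M ^ c * (M * ∑ B (λ K → χ K * length K) + M ^ length B * d) ≤
              ∑ (v ∷ A) (λ K → ψ (J ++ K))
      lower = begin
        M ^ c * (M * ∑ B (λ K → χ K * length K) + M ^ length B * d)
          ≡⟨ rearrange M (M ^ c) _ (M ^ length B) d ⟩
        M * (M ^ c * ∑ B (λ K → χ K * length K)) + M ^ c * M ^ length B * d
          ≤⟨ +-mono-≤ (*-monoʳ-≤ M (*-monoʳ-≤ (M ^ c) (∑-mono B neighbours)))
                      (*-mono-≤ (≤-reflexive (sym M^A)) centre) ⟩
        M * (M ^ c * ∑ B (λ K → ψ (J ++ K))) + M ^ length A * ψ (J ++ v ∷ [])
          ≤⟨ +-mono-≤ (*-monoʳ-≤ M (∑-filter-≤ free? A (λ K → ψ (J ++ K))))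
                      (∑-empty-≤ A (λ K → ψ (J ++ v ∷ K))) ⟩
        ∑ (v ∷ A) (λ K → ψ (J ++ K)) ∎
        where
        open ≤-Reasoning
        rearrange : ∀ m p z q d → p * (m * z + q * d) ≡ m * (p * z) + p * q * d
        rearrange = solve-∀

      -- After removal of the common factor `M ^ c`, `upper` and `lower` are joined by
      -- `neighbourhood`.
      conditional : ℓ * ∑ (v ∷ A) (λ K → χ (J ++ K)) ≤ ∑ (v ∷ A) (λ K → ψ (J ++ K))
      conditional = begin
        ℓ * ∑ (v ∷ A) (λ K → χ (J ++ K))            ≤⟨ *-monoʳ-≤ ℓ upper ⟩
        ℓ * (M ^ c * (M * Z B + M ^ length B))      ≡⟨ rearrange ℓ (M ^ c) _ ⟩
        M ^ c * (ℓ * (M * Z B + M ^ length B))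
          ≤⟨ *-monoʳ-≤ (M ^ c) (neighbourhood ℓ ℓ≤d
               (AllPairs.filter⁺ free? (AllPairs.filter⁺ (E? v) uq)) degree-B) ⟩
        M ^ c * (M * ∑ B (λ K → χ K * length K) + M ^ length B * d) ≤⟨ lower ⟩
        ∑ (v ∷ A) (λ K → ψ (J ++ K))                ∎
        where
        open ≤-Reasoning
        rearrange : ∀ a b c → a * (b * c) ≡ b * (a * c)
        rearrange = solve-∀
        degree-B : ∀ {u} → u ∈ B → degree u B ≤ s
        degree-B {u} u∈B = ≤-trans (degree-⊆ u (Sublist.filter-⊆ free? A))
          (codegree (proj₁ (∈-filter⁻ free? {xs = A} u∈B)))

    -- In the order O ++ v ∷ A, `∑-++` becomes conditioning on the restriction J to O. The bound for
    -- each independent J is then averaged, and a dependent J contributes 0 on the left.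
    vertex-≥ : ∀ {v d ℓ xs} → ℓ * (M * 16 ^ ℓ + 1) ≤ d → Unique xs → v ∈ xs →
      (∀ {u} → u ∈ xs → E v u → degree u (filter (E? v) xs) ≤ s) →
      ℓ * Z xs ≤ ∑ xs (λ I → χ I * sum (map (λ w → d * 𝟙 (w ≟ v) + 𝟙 (E? w v)) I))
    vertex-≥ {v} {d} {ℓ} {xs} ℓ≤d uq v∈xs codeg with ∈⇒↭ v∈xs
    ... | ys , xs↭ = begin
      ℓ * Z xs                                            ≡⟨ cong (ℓ *_) (∑-↭ χ-↭ p) ⟩
      ℓ * Z (O ++ v ∷ A)                                  ≡⟨ cong (ℓ *_) (∑-++ O (v ∷ A) χ) ⟩
      ℓ * ∑ O (λ J → ∑ (v ∷ A) (λ K → χ (J ++ K)))        ≡⟨ ∑-*ˡ O ℓ _ ⟨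
      ∑ O (λ J → ℓ * ∑ (v ∷ A) (λ K → χ (J ++ K)))        ≤⟨ ∑-mono O given ⟩
      ∑ O (λ J → ∑ (v ∷ A) (λ K → ψ (J ++ K)))            ≡⟨ ∑-++ O (v ∷ A) ψ ⟨
      ∑ (O ++ v ∷ A) ψ                                    ≡⟨ ∑-↭ (weighted-↭ _) p ⟨
      ∑ xs ψ                                              ∎
      where
      open ≤-Reasoning
      A = filter (E? v) ys
      O = filter (¬? ∘ E? v) ys
      ψ : List V → ℕ
      ψ I = χ I * sum (map (λ w → d * 𝟙 (w ≟ v) + 𝟙 (E? w v)) I)
      p : xs ↭ O ++ v ∷ A
      p = ↭-trans xs↭ (↭-trans (prep v (filter-split (E? v) ys)) (↭-sym (Perm.shift v O A)))
      uq′ : Unique ys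
      uq′ with AllPairs-resp-↭ (λ x≢y → x≢y ∘ sym) xs↭ uq
      ... | _ ∷ uq-ys = uq-ys
      codeg′ : ∀ {u} → u ∈ A → degree u A ≤ s
      codeg′ {u} u∈A with ∈-filter⁻ (E? v) {xs = ys} u∈A
      ... | u∈ys , e = begin
        degree u A                         ≤⟨ degree-⊆ u (Sublist.filter⁺ (E? v) (E? v) (λ { refl e → e })
                                                (v ∷ʳ Sublist.⊆-refl)) ⟩
        degree u (filter (E? v) (v ∷ ys))  ≡⟨ Perm.↭-length (Perm.filter-↭ (E? u) (Perm.filter-↭ (E? v) xs↭)) ⟨
        degree u (filter (E? v) xs)        ≤⟨ codeg (Perm.∈-resp-↭ (↭-sym xs↭) (there u∈ys)) e ⟩
        s                                  ∎
      given : ∀ {J} → J ⊆ O →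
              ℓ * ∑ (v ∷ A) (λ K → χ (J ++ K)) ≤ ∑ (v ∷ A) (λ K → ψ (J ++ K))
      given {J} J⊆O with indep? J
      ... | yes i = Conditional.conditional {ℓ = ℓ} ℓ≤d uq′ codeg′ J⊆O i
      ... | no ¬i = begin
        ℓ * ∑ (v ∷ A) (λ K → χ (J ++ K))  ≡⟨ cong (ℓ *_) (∑-zero (v ∷ A) λ {K} _ →
                                              𝟙-no (indep? (J ++ K)) (¬i ∘ AllPairs-++⁻ˡ J)) ⟩
        ℓ * 0                             ≡⟨ *-zeroʳ ℓ ⟩
        0                                 ≤⟨ z≤n ⟩
        ∑ (v ∷ A) (λ K → ψ (J ++ K))      ∎

    -- Adding `vertex-≥` over all v bounds ℓ times the number of vertices by the mean of a sum over
    -- w in I, where each w counts at most 2d and I has at most n members. Finally `Z xs` is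
    -- cancelled; it is positive because of the empty set.
    locally-sparse : ∀ {d n ℓ xs} → ℓ * (M * 16 ^ ℓ + 1) ≤ d → Unique xs →
      (∀ {u} → u ∈ xs → degree u xs ≤ d) →
      (∀ {u v} → u ∈ xs → v ∈ xs → E v u → degree u (filter (E? v) xs) ≤ s) →
      (∀ {I} → I ⊆ xs → Indep I → length I ≤ n) →
      length xs * ℓ ≤ 2 * d * n
    locally-sparse {d} {n} {ℓ} {xs} ℓ≤d uq deg codeg small =
      *-cancelʳ-≤ (length xs * ℓ) (2 * d * n) (Z xs) {{>-nonZero Z>0}} (begin
        length xs * ℓ * Z xs      ≡⟨ *-assoc (length xs) ℓ (Z xs) ⟩
        length xs * (ℓ * Z xs)    ≤⟨ ∑-weighted h xs xs (λ {v} v∈xs →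
                                       vertex-≥ {d = d} {ℓ} ℓ≤d uq v∈xs (λ u∈xs → codeg u∈xs v∈xs)) ⟩
        ∑ xs (λ I → χ I * sum (map (λ v → sum (map (h v) I)) xs))
                                  ≤⟨ ∑-mono xs bound ⟩
        ∑ xs (λ I → 2 * d * n * χ I)  ≡⟨ ∑-*ˡ xs (2 * d * n) χ ⟩
        2 * d * n * Z xs          ∎)
      where
      open ≤-Reasoning
      h : V → V → ℕ
      h v w = d * 𝟙 (w ≟ v) + 𝟙 (E? w v)
      Z>0 : 0 < Z xs
      Z>0 = ≤-trans (*-mono-≤ (m^n>0 M (length xs)) (𝟙-yes (indep? []) [])) (∑-empty-≤ xs χ)
      total : ∀ {w} → w ∈ xs → sum (map (λ v → h v w) xs) ≤ 2 * d
      total {w} w∈xs = begin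
        sum (map (λ v → h v w) xs)
          ≡⟨ sum-+ (λ v → d * 𝟙 (w ≟ v)) (λ v → 𝟙 (E? w v)) xs ⟩
        sum (map (λ v → d * 𝟙 (w ≟ v)) xs) + sum (map (λ v → 𝟙 (E? w v)) xs)
          ≡⟨ cong₂ _+_ (sum-*ˡ d (λ v → 𝟙 (w ≟ v)) xs) (sum-𝟙 (E? w) xs) ⟩
        d * sum (map (λ v → 𝟙 (w ≟ v)) xs) + degree w xs
          ≤⟨ +-mono-≤ (*-monoʳ-≤ d (equals≤1 w uq)) (deg w∈xs) ⟩
        d * 1 + d
          ≡⟨ rearrange d ⟩
        2 * d ∎
        where
        rearrange : ∀ d → d * 1 + d ≡ 2 * d
        rearrange = solve-∀
      bound : ∀ {I} → I ⊆ xs →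
              χ I * sum (map (λ v → sum (map (h v) I)) xs) ≤ 2 * d * n * χ I
      bound {I} I⊆xs with indep? I
      ... | no _  = z≤n
      ... | yes i = begin
        1 * sum (map (λ v → sum (map (h v) I)) xs) ≡⟨ *-identityˡ _ ⟩
        sum (map (λ v → sum (map (h v) I)) xs)
          ≤⟨ double-count h xs {I} (total ∘ Sublist.lookup I⊆xs) ⟩
        2 * d * length I                           ≤⟨ *-monoʳ-≤ (2 * d) (small I⊆xs i) ⟩
        2 * d * n                                  ≡⟨ *-identityʳ _ ⟨
        2 * d * n * 1                              ∎

-- Ramsey numbers

AllPairs-resp-⊆ : {A : Set} {R : A → A → Set} {xs ys : List A} →
                  xs ⊆ ys → AllPairs R ys → AllPairs R xs
AllPairs-resp-⊆ []          []       = []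
AllPairs-resp-⊆ (_ ∷ʳ s)    (_ ∷ rs) = AllPairs-resp-⊆ s rs
AllPairs-resp-⊆ (refl ∷ s)  (r ∷ rs) = Sublist.All-resp-⊆ s r ∷ AllPairs-resp-⊆ s rs

*≤⇒≤/ : ∀ {m n o} .{{_ : NonZero n}} → m * n ≤ o → m ≤ o / n
*≤⇒≤/ {m} {n} le = subst (_≤ _) (m*n/n≡m m n) (/-monoˡ-≤ n le)

m≤2^m : ∀ m → m ≤ 2 ^ m
m≤2^m zero    = z≤n
m≤2^m (suc m) = begin
  1 + m          ≤⟨ +-mono-≤ (m^n>0 2 m) (m≤2^m m) ⟩
  2 ^ m + 2 ^ m  ≡⟨ cong (2 ^ m +_) (+-identityʳ (2 ^ m)) ⟨
  2 ^ suc m      ∎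
  where open ≤-Reasoning

length-filter-split : {A : Set} {P : A → Set} (P? : Decidable P) (xs : List A) →
  length xs ≡ length (filter (¬? ∘ P?) xs) + length (filter P? xs)
length-filter-split P? xs =
  trans (Perm.↭-length (filter-split P? xs)) (length-++ (filter (¬? ∘ P?) xs))

module Ramsey {V : Set} (_≟_ : DecidableEquality V)
              {E : V → V → Set} (E? : ∀ u v → Dec (E u v)) (E-sym : Symmetric E) where

  open Independence _≟_ E? E-sym

  NoClique : ℕ → List V → Set
  NoClique k xs = ∀ {vs} → All (_∈ xs) vs → AllPairs E vs → length vs < k

  -- Distinctness is demanded since copies of one loopless vertex are pairwise non-adjacent. In
  -- `NoClique` it is `E` that excludes copies: a loop would give cliques of every length.
  NoIndep : ℕ → List V → Set
  NoIndep n xs = ∀ {vs} → All (_∈ xs) vs → Unique vs → Indep vs → length vs < n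

  noClique-neighbours : ∀ {k v xs} → v ∈ xs → NoClique (suc k) xs → NoClique k (filter (E? v) xs)
  noClique-neighbours {v = v} {xs} v∈xs nc {vs} vs∈ clique = s<s⁻¹ (nc
    (v∈xs ∷ All.map (proj₁ ∘ ∈-filter⁻ (E? v) {xs = xs}) vs∈)
    (All.map (proj₂ ∘ ∈-filter⁻ (E? v) {xs = xs}) vs∈ ∷ clique))

  noClique-⊆ : ∀ {k xs ys} → xs ⊆ ys → NoClique k ys → NoClique k xs
  noClique-⊆ s nc vs∈ = nc (All.map (Sublist.lookup s) vs∈)

  noIndep-⊆ : ∀ {n xs ys} → xs ⊆ ys → NoIndep n ys → NoIndep n xs
  noIndep-⊆ s ni vs∈ = ni (All.map (Sublist.lookup s) vs∈)

  -- Passing to the neighbours of the first vertex lowers the clique bound, passing to its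
  -- non-neighbours the independence bound, and n^(i+1) + (n+1)^i ≤ (n+1)^(i+1). Strictness accounts
  -- for the vertex itself.
  erdős-szekeres : ∀ i n {xs} → Unique xs → NoClique (suc i) xs → NoIndep n xs → length xs < n ^ i
  erdős-szekeres i       zero    uq nc ni = contradiction (ni [] [] []) λ ()
  erdős-szekeres zero    (suc n) {[]}     uq nc ni = s≤s z≤n
  erdős-szekeres zero    (suc n) {x ∷ xs} uq nc ni =
    contradiction (nc (here refl ∷ []) ([] ∷ [])) λ { (s≤s ()) }
  erdős-szekeres (suc i) (suc n) {[]}     uq nc ni = m^n>0 (suc n) (suc i)
  erdős-szekeres (suc i) (suc n) {x ∷ xs} (x∉xs ∷ uq) nc ni = begin
    2 + length xs                        ≡⟨ cong (2 +_) (length-filter-split (E? x) xs) ⟩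
    2 + (length O + length A)            ≡⟨ +-suc (suc (length O)) (length A) ⟨
    suc (length O) + suc (length A)      ≤⟨ +-mono-≤ O< A< ⟩
    n ^ suc i + suc n ^ i                ≤⟨ +-monoˡ-≤ _ (*-monoʳ-≤ n (^-monoˡ-≤ i (n≤1+n n))) ⟩
    n * suc n ^ i + suc n ^ i            ≡⟨ +-comm (n * suc n ^ i) (suc n ^ i) ⟩
    suc n ^ suc i                        ∎
    where
    open ≤-Reasoning
    A = filter (E? x) xs
    O = filter (¬? ∘ E? x) xs
    A< : length A < suc n ^ i
    A< = erdős-szekeres i (suc n) (AllPairs.filter⁺ (E? x) uq)
      (noClique-⊆ (Sublist.filter⁺ (E? x) (E? x) (λ { refl e → e }) (x ∷ʳ Sublist.⊆-refl))
        (noClique-neighbours (here refl) nc))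
      (noIndep-⊆ (x ∷ʳ Sublist.filter-⊆ (E? x) xs) ni)
    O< : length O < n ^ suc i
    O< = erdős-szekeres (suc i) n (AllPairs.filter⁺ (¬? ∘ E? x) uq)
      (noClique-⊆ (x ∷ʳ Sublist.filter-⊆ (¬? ∘ E? x) xs) nc)
      λ {vs} vs∈ uq-vs indep →
        let in-O = λ {w} → ∈-filter⁻ (¬? ∘ E? x) {v = w} {xs = xs} in
        s<s⁻¹ (ni (here refl ∷ All.map (there ∘ proj₁ ∘ in-O) vs∈)
                  (All.map (All.lookup x∉xs ∘ proj₁ ∘ in-O) vs∈ ∷ uq-vs)
                  (All.map (proj₂ ∘ in-O) vs∈ ∷ indep))

  -- The Ramsey bound of Ajtai, Komlós and Szemerédi; ℓ has the order of log n.
  ramsey : ∀ i {n ℓ xs} → (2 ^ ℓ) ^ (i + 4) ≤ n → Unique xs →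
    NoClique (2 + i) xs → NoIndep n xs → length xs * ℓ ^ i ≤ 5 * 2 ^ i * n ^ suc i
  ramsey zero {n} {ℓ} {xs} _ uq nc ni = begin
    length xs * 1       ≡⟨ *-identityʳ (length xs) ⟩
    length xs           ≤⟨ <⇒≤ (erdős-szekeres 1 n uq nc ni) ⟩
    n ^ 1               ≤⟨ m≤n*m (n ^ 1) 5 ⟩
    5 * n ^ 1           ∎
    where open ≤-Reasoning
  ramsey (suc i) {n} {zero}    {xs} _ uq nc ni = ≤-trans (≤-reflexive (*-zeroʳ (length xs))) z≤n
  ramsey (suc i) {n} {ℓ@(suc _)} {xs} n-large uq nc ni = begin
    length xs * (ℓ * P)          ≡⟨ *-assoc (length xs) ℓ P ⟨
    -- One factor ℓ comes from `locally-sparse`, the other i from the definition of d. The 2 in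
    -- `2 * d * n` raises 2^i to 2^(i+1).
    length xs * ℓ * P            ≤⟨ *-monoˡ-≤ P sparse ⟩
    2 * d * n * P                ≡⟨ rearrange₁ d n P ⟩
    2 * n * (d * P)              ≤⟨ *-monoʳ-≤ (2 * n) (m/n*n≤m _ P) ⟩
    2 * n * (5 * 2 ^ i * n ^ suc i)   ≡⟨ rearrange₂ n (2 ^ i) (n ^ suc i) ⟩
    5 * 2 ^ suc i * n ^ suc (suc i)   ∎
    where
    open ≤-Reasoning
    rearrange₁ : ∀ d n p → 2 * d * n * p ≡ 2 * n * (d * p)
    rearrange₁ = solve-∀
    rearrange₂ : ∀ n c p → 2 * n * (5 * c * p) ≡ 5 * (2 * c) * (n * p)
    rearrange₂ = solve-∀
    rearrange₃ : ∀ l x w p → l * (2 * (1 + x) * w + 1) * p ≡ 2 * x * (l * p * w) + 2 * (l * p * w) + l * p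
    rearrange₃ = solve-∀
    rearrange₄ : ∀ x y → 2 * x * y + 2 * (x * y) + x * y ≡ 5 * (x * y)
    rearrange₄ = solve-∀
    P = ℓ ^ i
    instance
      P≢0 : NonZero P
      P≢0 = m^n≢0 ℓ i
      2^≢0 : NonZero (2 ^ ℓ)
      2^≢0 = m^n≢0 2 ℓ
    -- This is the degree bound supplied by the induction hypothesis, as neighbourhoods contain no
    -- clique of size i + 2.
    d = (5 * 2 ^ i * n ^ suc i) / P
    n>0 : 0 < n
    n>0 = ≤-trans (m^n>0 (2 ^ ℓ) (suc i + 4)) n-large
    n^i>0 : 0 < n ^ i
    n^i>0 = m^n>0 n {{>-nonZero n>0}} i
    n-large′ : (2 ^ ℓ) ^ (i + 4) ≤ n
    n-large′ = ≤-trans (^-monoʳ-≤ (2 ^ ℓ) (n≤1+n (i + 4))) n-large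
    -- The exponent in the hypothesis on n originates here: i + 1 factors 2^ℓ dominate ℓ^(i+1), and
    -- four more make up 16^ℓ.
    powers : ℓ * P * 16 ^ ℓ ≤ n
    powers = begin
      ℓ ^ suc i * 16 ^ ℓ               ≤⟨ *-mono-≤ (^-monoˡ-≤ (suc i) (m≤2^m ℓ)) (≤-reflexive 16^ℓ) ⟩
      (2 ^ ℓ) ^ suc i * (2 ^ ℓ) ^ 4    ≡⟨ ^-distribˡ-+-* (2 ^ ℓ) (suc i) 4 ⟨
      (2 ^ ℓ) ^ (suc i + 4)            ≤⟨ n-large ⟩
      n                                ∎
      where
      16^ℓ : 16 ^ ℓ ≡ (2 ^ ℓ) ^ 4
      16^ℓ = trans (^-*-assoc 2 4 ℓ) (trans (cong (2 ^_) (*-comm 4 ℓ)) (sym (^-*-assoc 2 ℓ 4)))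
    -- The three summands give 2 + 2 + 1 multiples of n^(i+1), whence the constant 5.
    d-large : ℓ * (2 * suc (n ^ i) * 16 ^ ℓ + 1) ≤ d
    d-large = *≤⇒≤/ (begin
      ℓ * (2 * suc (n ^ i) * 16 ^ ℓ + 1) * P
        ≡⟨ rearrange₃ ℓ (n ^ i) (16 ^ ℓ) P ⟩
      2 * n ^ i * (ℓ * P * 16 ^ ℓ) + 2 * (ℓ * P * 16 ^ ℓ) + ℓ * P
        ≤⟨ +-mono-≤ (+-mono-≤ (*-monoʳ-≤ (2 * n ^ i) powers)
                              (*-monoʳ-≤ 2 (≤-trans powers n≤)))
                    (≤-trans (m≤m*n (ℓ * P) (16 ^ ℓ) {{m^n≢0 16 ℓ}}) (≤-trans powers n≤)) ⟩
      2 * n ^ i * n + 2 * (n ^ i * n) + n ^ i * n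
        ≡⟨ rearrange₄ (n ^ i) n ⟩
      5 * (n ^ i * n)
        ≤⟨ *-mono-≤ (m≤m*n 5 (2 ^ i) {{m^n≢0 2 i}}) (≤-reflexive (*-comm (n ^ i) n)) ⟩
      5 * 2 ^ i * n ^ suc i ∎)
      where
      n≤ : n ≤ n ^ i * n
      n≤ = m≤n*m n (n ^ i) {{>-nonZero n^i>0}}
    degree≤ : ∀ {u} → u ∈ xs → degree u xs ≤ d
    degree≤ {u} u∈xs = *≤⇒≤/ (ramsey i {ℓ = ℓ} n-large′ (AllPairs.filter⁺ (E? u) uq)
      (noClique-neighbours u∈xs nc) (noIndep-⊆ (Sublist.filter-⊆ (E? u) xs) ni))
    -- The common neighbourhood of an edge contains no clique of size i + 1. The bound without
    -- logarithms suffices, since d exceeds n^i by a factor of order n / ℓ^i.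
    codegree≤ : ∀ {u v} → u ∈ xs → v ∈ xs → E v u → degree u (filter (E? v) xs) ≤ n ^ i
    codegree≤ {u} {v} u∈xs v∈xs e = <⇒≤ (erdős-szekeres i n
      (AllPairs.filter⁺ (E? u) (AllPairs.filter⁺ (E? v) uq))
      (noClique-neighbours (∈-filter⁺ (E? v) u∈xs e) (noClique-neighbours v∈xs nc))
      (noIndep-⊆ (Sublist.⊆-trans (Sublist.filter-⊆ (E? u) _) (Sublist.filter-⊆ (E? v) xs)) ni))
    sparse : length xs * ℓ ≤ 2 * d * n
    sparse = Local.locally-sparse (n ^ i) {ℓ = ℓ} d-large uq degree≤ codegree≤
      λ I⊆xs indep → <⇒≤ (ni (All.tabulate (Sublist.lookup I⊆xs)) (AllPairs-resp-⊆ I⊆xs uq) indep)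

-- Builder's strategy

_≟ᶜ_ : DecidableEquality Colour
red  ≟ᶜ red  = yes refl
red  ≟ᶜ blue = no λ ()
blue ≟ᶜ red  = no λ ()
blue ≟ᶜ blue = yes refl

open DecMembership (×-≡-dec _≟ᶜ_ (×-≡-dec _≟_ _≟_)) using (_∈?_)

edge? : ∀ b c u v → Dec (Edge b c u v)
edge? b c u v = ((c , u , v) ∈? b) ⊎-dec ((c , v , u) ∈? b)

adjacent? : ∀ b u v → Dec (Adjacent b u v)
adjacent? b u v = map′ (λ { (inj₁ e) → red , e ; (inj₂ e) → blue , e })
                       (λ { (red , e) → inj₁ e ; (blue , e) → inj₂ e })
                       (edge? b red u v ⊎-dec edge? b blue u v)

-- A board is an arbitrary list and may contain loops. Requiring distinct ends makes the relation
-- irreflexive, as the Ramsey bounds expect, and supplies the `Unique` part of a `Clique`.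
Link : Board → Colour → ℕ → ℕ → Set
Link b c u v = u ≢ v × Edge b c u v

link? : ∀ b c u v → Dec (Link b c u v)
link? b c u v = ¬? (u ≟ v) ×-dec edge? b c u v

link-sym : ∀ {b c} → Symmetric (Link b c)
link-sym (u≢v , inj₁ e) = u≢v ∘ sym , inj₂ e
link-sym (u≢v , inj₂ e) = u≢v ∘ sym , inj₁ e

adjacent-sym : ∀ {b} → Symmetric (Adjacent b)
adjacent-sym (c , inj₁ e) = c , inj₂ e
adjacent-sym (c , inj₂ e) = c , inj₁ e

¬red⇒blue : ∀ {b u v} → u ≢ v → Adjacent b u v → ¬ Link b red u v → Link b blue u v
¬red⇒blue u≢v (red  , e) ¬r = contradiction (u≢v , e) ¬r
¬red⇒blue u≢v (blue , e) ¬r = u≢v , e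

_⊑_ : Board → Board → Set
b ⊑ b′ = ∀ {e} → e ∈ b → e ∈ b′

edge-mono : ∀ {b b′ c u v} → b ⊑ b′ → Edge b c u v → Edge b′ c u v
edge-mono s (inj₁ e) = inj₁ (s e)
edge-mono s (inj₂ e) = inj₂ (s e)

link-mono : ∀ {b b′ c u v} → b ⊑ b′ → Link b c u v → Link b′ c u v
link-mono {b′ = b′} s (u≢v , e) = u≢v , edge-mono {b′ = b′} s e

adjacent-mono : ∀ {b b′ u v} → b ⊑ b′ → Adjacent b u v → Adjacent b′ u v
adjacent-mono {b′ = b′} s (c , e) = c , edge-mono {b′ = b′} s e

AllPairs-lookup : {A : Set} {R : A → A → Set} → Symmetric R → ∀ {xs u v} →
                  AllPairs R xs → u ∈ xs → v ∈ xs → u ≢ v → R u v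
AllPairs-lookup R-sym (r ∷ rs) (here refl) (here refl) u≢v = contradiction refl u≢v
AllPairs-lookup R-sym (r ∷ rs) (here refl) (there v∈)  u≢v = All.lookup r v∈
AllPairs-lookup R-sym (r ∷ rs) (there u∈)  (here refl) u≢v = R-sym (All.lookup r u∈)
AllPairs-lookup R-sym (r ∷ rs) (there u∈)  (there v∈)  u≢v = AllPairs-lookup R-sym rs u∈ v∈ u≢v

module Game (m n : ℕ) where

  wins-mono : ∀ {t t′ b} → t ≤ t′ → BuilderWins m n t b → BuilderWins m n t′ b
  wins-mono t≤t′       (won w)                    = won w
  wins-mono (s≤s t≤t′) (turn u v u≢v fresh next) =
    turn u v u≢v fresh λ c → wins-mono t≤t′ (next c)

  clique⇒won : ∀ {b k c vs} → (Clique b c k → Won m n b) → k ≤ length vs →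
               AllPairs (Link b c) vs → Won m n b
  clique⇒won {k = k} {vs = vs} win k≤ ls =
    win (take k vs , trans (length-take k vs) (m≤n⇒m⊓n≡m k≤) ,
         AllPairs.map proj₁ (AllPairs.take⁺ k ls) , AllPairs.map proj₂ (AllPairs.take⁺ k ls))

  -- In continuation style: `next` spends the last t turns on whichever board Painter's answers
  -- produce. Edges already present are skipped.
  star : ∀ x us {t b} → All (x ≢_) us →
    (∀ b′ → b ⊑ b′ → All (Adjacent b′ x) us → BuilderWins m n t b′) →
    BuilderWins m n (length us + t) b
  star x []       {b = b} _ next = next b id []
  star x (u ∷ us) {b = b} (x≢u ∷ x≢us) next with adjacent? b x u
  ... | yes a = wins-mono (n≤1+n _) (star x us x≢us λ b′ s as →
          next b′ s (adjacent-mono {b′ = b′} s a ∷ as))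
  ... | no ¬a = turn x u x≢u ¬a λ c → star x us x≢us λ b′ s as →
          next b′ (s ∘ there) ((c , inj₁ (s (here refl))) ∷ as)

  complete : ∀ us {t b} → Unique us →
    (∀ b′ → b ⊑ b′ → AllPairs (Adjacent b′) us → BuilderWins m n t b′) →
    BuilderWins m n (length us * length us + t) b
  complete []       {b = b} _ next = next b id []
  complete (u ∷ us) {t} (u≢us ∷ uq) next =
    wins-mono l+l²≤ (star u us u≢us λ b₁ s₁ as → complete us uq λ b₂ s₂ ps →
      next b₂ (s₂ ∘ s₁) (All.map (adjacent-mono {b′ = b₂} s₂) as ∷ ps))
    where
    l = length us
    l+l²≤ : l + (l * l + t) ≤ suc l * suc l + t
    l+l²≤ = begin
      l + (l * l + t)             ≡⟨ +-assoc l (l * l) t ⟨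
      l + l * l + t               ≤⟨ +-monoˡ-≤ t (+-mono-≤ (n≤1+n l) (*-monoʳ-≤ l (n≤1+n l))) ⟩
      suc l * suc l + t           ∎
      where open ≤-Reasoning

  record Cone (b : Board) (c : Colour) (P U : List ℕ) : Set where
    constructor cone
    field
      clique : AllPairs (Link b c) P
      joined : All (λ u → All (Link b c u) P) U

  open Cone

  cone-mono : ∀ {b b′ c P U} → b ⊑ b′ → Cone b c P U → Cone b′ c P U
  cone-mono {b′ = b′} s (cone cl jn) =
    cone (AllPairs.map (link-mono {b′ = b′} s) cl)
         (All.map (All.map (link-mono {b′ = b′} s)) jn)

  cone-filter : ∀ {b c P U} {Q : ℕ → Set} (Q? : Decidable Q) → Cone b c P U →
                Cone b c P (filter Q? U)
  cone-filter Q? (cone cl jn) = cone cl (All.filter⁺ Q? jn)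

  cone-tail : ∀ {b c P x U} → Cone b c P (x ∷ U) → Cone b c P U
  cone-tail (cone cl (_ ∷ jn)) = cone cl jn

  cone-push : ∀ {b c P x U A} → Cone b c P (x ∷ U) → Cone b c P A →
              All (Link b c x) A → Cone b c (x ∷ P) A
  cone-push (cone cl (jx ∷ _)) (cone _ jA) ls =
    cone (jx ∷ cl) (All.zipWith (λ (l , js) → link-sym l ∷ js) (ls , jA))

  -- Builder keeps a red clique P joined in red to U and a blue clique Q joined
  -- in blue to U, and connects a vertex of U to the rest of U. Either it has
  -- size j red neighbours, and they and the extended P enter the next level, or
  -- Q is extended and U loses at most size j vertices. Level 0 is resolved by
  -- the complete graph on U.
  module Strategy (k N₀ : ℕ) (n>0 : 0 < n) (N₀>0 : 0 < N₀)
    (ramsey-N₀ : ∀ {E : ℕ → ℕ → Set} (E? : ∀ u v → Dec (E u v)) (E-sym : Symmetric E) {xs} →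
      Unique xs → Ramsey.NoClique _≟_ E? E-sym k xs → Ramsey.NoIndep _≟_ E? E-sym n xs →
      length xs < N₀) where

    size : ℕ → ℕ
    size zero    = N₀
    size (suc j) = n * size j

    -- A level needs at most n stars, each inside at most `size (suc j)` vertices, and is left for
    -- the next level at most once.
    cost : ℕ → ℕ
    cost zero    = N₀ * N₀ + 0
    cost (suc j) = n * size (suc j) + cost j

    size>0 : ∀ j → 0 < size j
    size>0 zero    = N₀>0
    size>0 (suc j) = *-mono-≤ n>0 (size>0 j)

    -- A red clique of size k in U together with P is a red K_m, and a red-independent set in the
    -- completed U is a blue clique. With neither of the required size, U would contradict
    -- `ramsey-N₀`.
    finish : ∀ {b P U} → Cone b red P U → length P + k ≡ m → Unique U → length U ≡ N₀ →
             BuilderWins m n (N₀ * N₀ + 0) b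
    finish {b} {P} {U} cn lP uq refl = complete U uq resolve
      where
      resolve : ∀ b′ → b ⊑ b′ → AllPairs (Adjacent b′) U → BuilderWins m n 0 b′
      -- Deciding whether the final board is won makes the argument by contradiction constructive.
      resolve b′ s adj with builderWins? m n 0 b′
      ... | yes w = w
      ... | no ¬w = contradiction (ramsey-N₀ (link? b′ red) link-sym uq noClique noIndep) (<-irrefl refl)
        where
        open Ramsey _≟_ (link? b′ red) link-sym
        noClique : NoClique k U
        noClique {vs} vs∈ cl = ≰⇒> λ k≤ → ¬w (won (clique⇒won inj₁
          (≤-trans (≤-reflexive (trans (sym lP) (+-comm (length P) k)))
            (≤-trans (+-monoˡ-≤ (length P) k≤) (≤-reflexive (sym (length-++ vs)))))
          (AllPairs.++⁺ cl (AllPairs.map (link-mono {b′ = b′} s) (clique cn))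
            (All.map (All.lookup (joined (cone-mono {b′ = b′} s cn))) vs∈))))
        blues : ∀ {vs} → All (_∈ U) vs → Unique vs → AllPairs (λ u v → ¬ Link b′ red u v) vs →
                AllPairs (Link b′ blue) vs
        blues []         []          []           = []
        blues (u∈ ∷ us∈) (u≢ ∷ uq′) (¬r ∷ ¬rs) =
          All.tabulate (λ w∈ → let u≢w = All.lookup u≢ w∈ in
            ¬red⇒blue u≢w (AllPairs-lookup adjacent-sym adj u∈ (All.lookup us∈ w∈) u≢w)
                      (All.lookup ¬r w∈)) ∷
          blues us∈ uq′ ¬rs
        noIndep : NoIndep n U
        noIndep vs∈ uq-vs ind = ≰⇒> λ n≤ → ¬w (won (clique⇒won inj₂ n≤ (blues vs∈ uq-vs ind)))

    enter : ∀ j {b P U} → Cone b red P U → length P + (j + k) ≡ m → Unique U →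
            length U ≡ size j → BuilderWins m n (cost j) b
    -- `r` is the number of vertices still missing from Q. The lower bound on U keeps it nonempty
    -- while r > 0; the upper bound limits the price of each star.
    play  : ∀ j r {b P Q U} → Cone b red P U → length P + (suc j + k) ≡ m →
            Cone b blue Q U → length Q + r ≡ n → Unique U →
            r * size j ≤ length U → length U ≤ size (suc j) →
            BuilderWins m n (r * size (suc j) + cost j) b

    enter zero    cn lP uq lU = finish cn lP uq lU
    enter (suc j) cn lP uq lU =
      play j n cn lP (cone [] (All.universal (λ _ → []) _)) refl uq
        (≤-reflexive (sym lU)) (≤-reflexive lU)

    play j zero {Q = Q} cnR lP cnB lQ uq _ _ =
      won (clique⇒won inj₂ (≤-reflexive (trans (sym lQ) (+-identityʳ (length Q)))) (clique cnB))
    play j (suc r) {U = []} cnR lP cnB lQ uq large _ =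
      contradiction (≤-trans (size>0 j) (≤-trans (m≤m+n (size j) (r * size j)) large)) λ ()
    play j (suc r) {b} {P} {Q} {U@(x ∷ xs)} cnR lP cnB lQ (x∉xs ∷ uq) large small =
      wins-mono budget (star x xs x∉xs next)
      where
      budget : length xs + (r * size (suc j) + cost j) ≤ suc r * size (suc j) + cost j
      budget = ≤-trans (+-monoˡ-≤ _ (≤-trans (n≤1+n (length xs)) small))
                       (≤-reflexive (sym (+-assoc (size (suc j)) (r * size (suc j)) (cost j))))
      next : ∀ b′ → b ⊑ b′ → All (Adjacent b′ x) xs →
             BuilderWins m n (r * size (suc j) + cost j) b′
      next b′ s adj with size j ≤? length (filter (link? b′ red x) xs)
      ... | yes many = wins-mono (m≤n+m (cost j) _)
        (enter j {U = take (size j) A} red-cone (trans (sym (+-suc (length P) (j + k))) lP)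
          (AllPairs.take⁺ (size j) (AllPairs.filter⁺ (link? b′ red x) uq))
          (trans (length-take (size j) A) (m≤n⇒m⊓n≡m many)))
        where
        A = filter (link? b′ red x) xs
        red-cone : Cone b′ red (x ∷ P) (take (size j) A)
        red-cone with cone-push cnR′ (cone-filter (link? b′ red x) (cone-tail cnR′))
                        (All.all-filter (link? b′ red x) xs)
          where
          cnR′ : Cone b′ red P U
          cnR′ = cone-mono {b′ = b′} s cnR
        ... | cone cl jn = cone cl (All.take⁺ (size j) jn)
      ... | no few = play j r
        (cone-filter (¬? ∘ link? b′ red x) (cone-tail (cone-mono {b′ = b′} s cnR))) lP
        (cone-push cnB′ (cone-filter (¬? ∘ link? b′ red x) (cone-tail cnB′)) blues)
        (trans (sym (+-suc (length Q) r)) lQ)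
        (AllPairs.filter⁺ (¬? ∘ link? b′ red x) uq)
        enough
        (≤-trans (≤-trans (≤-trans (m≤m+n (length O) (length A))
          (≤-reflexive (sym (length-filter-split (link? b′ red x) xs)))) (n≤1+n _)) small)
        where
        A = filter (link? b′ red x) xs
        O = filter (¬? ∘ link? b′ red x) xs
        cnB′ : Cone b′ blue Q U
        cnB′ = cone-mono {b′ = b′} s cnB
        blues : All (Link b′ blue x) O
        blues = All.zipWith (λ ((x≢w , a) , ¬r) → ¬red⇒blue x≢w a ¬r)
          (All.filter⁺ (¬? ∘ link? b′ red x) (All.zip (x∉xs , adj)) ,
           All.all-filter (¬? ∘ link? b′ red x) xs)
        enough : r * size j ≤ length O
        -- Fewer than `size j` red neighbours are lost, so the loss is at most `size j` even with x
        -- included.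
        enough = +-cancelʳ-≤ (size j) (r * size j) (length O) (begin
          r * size j + size j          ≡⟨ +-comm (r * size j) (size j) ⟩
          suc r * size j               ≤⟨ large ⟩
          suc (length xs)              ≡⟨ cong suc (length-filter-split (link? b′ red x) xs) ⟩
          suc (length O + length A)    ≡⟨ +-suc (length O) (length A) ⟨
          length O + suc (length A)    ≤⟨ +-monoʳ-≤ (length O) (≰⇒> few) ⟩
          length O + size j            ∎)
          where open ≤-Reasoning

    builder-wins : ∀ j → j + k ≡ m → BuilderWins m n (cost j) []
    builder-wins j j+k≡m = enter j {U = upTo (size j)} (cone [] (All.universal (λ _ → []) _))
      j+k≡m (upTo⁺ (size j)) (length-upTo (size j))

-- The cost of the strategy

module Bound (i m n ℓ : ℕ) (3≤ : 2 + i ≤ m) (2i≤m : 2 * suc i ≤ m) (ℓ>0 : 0 < ℓ)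
  (n-large : (2 ^ ℓ) ^ (i + 4) ≤ n) where

  P = ℓ ^ i
  -- 5 * 2^i comes from the Ramsey bound, and one more 2^i pays for the `suc` in `N₀`.
  D = 6 * 2 ^ i

  instance
    ℓ≢0 : NonZero ℓ
    ℓ≢0 = >-nonZero ℓ>0
    P≢0 : NonZero P
    P≢0 = m^n≢0 ℓ i
    2^ℓ≢0 : NonZero (2 ^ ℓ)
    2^ℓ≢0 = m^n≢0 2 ℓ

  n>0 : 0 < n
  n>0 = ≤-trans (m^n>0 (2 ^ ℓ) (i + 4)) n-large

  instance
    n≢0 : NonZero n
    n≢0 = >-nonZero n>0

  N₀ : ℕ
  N₀ = suc ((5 * 2 ^ i * n ^ suc i) / P)

  ℓ≤n : ℓ ≤ n
  ℓ≤n = begin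
    ℓ                    ≤⟨ m≤2^m ℓ ⟩
    2 ^ ℓ                ≡⟨ ^-identityʳ (2 ^ ℓ) ⟨
    (2 ^ ℓ) ^ 1          ≤⟨ ^-monoʳ-≤ (2 ^ ℓ) (≤-trans (s≤s z≤n) (m≤n+m 4 i)) ⟩
    (2 ^ ℓ) ^ (i + 4)    ≤⟨ n-large ⟩
    n                    ∎
    where open ≤-Reasoning

  N₀*P≤ : N₀ * P ≤ D * n ^ suc i
  N₀*P≤ = begin
    P + (5 * 2 ^ i * n ^ suc i) / P * P
      ≤⟨ +-mono-≤ (≤-trans (^-monoˡ-≤ i ℓ≤n) (m≤n*m (n ^ i) n)) (m/n*n≤m _ P) ⟩
    n ^ suc i + 5 * 2 ^ i * n ^ suc i
      ≤⟨ +-monoˡ-≤ _ (m≤n*m (n ^ suc i) (2 ^ i) {{m^n≢0 2 i}}) ⟩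
    2 ^ i * n ^ suc i + 5 * 2 ^ i * n ^ suc i
      ≡⟨ rearrange (2 ^ i) (n ^ suc i) ⟩
    D * n ^ suc i ∎
    where
    open ≤-Reasoning
    rearrange : ∀ a b → a * b + 5 * a * b ≡ 6 * a * b
    rearrange = solve-∀

  open Game m n
  open Strategy (2 + i) N₀ n>0 (s≤s z≤n)
    (λ E? E-sym uq nc ni → s≤s (*≤⇒≤/ (Ramsey.ramsey _≟_ E? E-sym i {ℓ = ℓ} n-large uq nc ni)))

  size*P≤ : ∀ j → size j * P ≤ D * n ^ (j + suc i)
  size*P≤ zero    = N₀*P≤
  size*P≤ (suc j) = begin
    n * size j * P               ≡⟨ *-assoc n (size j) P ⟩
    n * (size j * P)             ≤⟨ *-monoʳ-≤ n (size*P≤ j) ⟩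
    n * (D * n ^ (j + suc i))    ≡⟨ rearrange n D _ ⟩
    D * n ^ (suc j + suc i)      ∎
    where
    open ≤-Reasoning
    rearrange : ∀ n d p → n * (d * p) ≡ d * (n * p)
    rearrange = solve-∀

  -- The complete graph costs N₀², and N₀² P ≤ (N₀ P)² ≤ D² n^(2(i+1)), which is within n^m by
  -- `2i≤m`. Each level of stars adds at most D n^m.
  cost*P≤ : ∀ j → j + (2 + i) ≤ m → cost j * P ≤ (D * D + j * D) * n ^ m
  cost*P≤ zero    _    = begin
    (N₀ * N₀ + 0) * P                    ≡⟨ rearrange₁ N₀ P ⟩
    N₀ * P * N₀                          ≤⟨ *-monoʳ-≤ (N₀ * P) (m≤m*n N₀ P) ⟩
    N₀ * P * (N₀ * P)                    ≤⟨ *-mono-≤ N₀*P≤ N₀*P≤ ⟩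
    D * n ^ suc i * (D * n ^ suc i)      ≡⟨ rearrange₂ D (n ^ suc i) ⟩
    (D * D + 0) * (n ^ suc i * n ^ suc i)
      ≡⟨ cong ((D * D + 0) *_) (^-distribˡ-+-* n (suc i) (suc i)) ⟨
    (D * D + 0) * n ^ (suc i + suc i)
      ≤⟨ *-monoʳ-≤ (D * D + 0) (^-monoʳ-≤ n (≤-trans (≤-reflexive
           (cong (suc i +_) (sym (+-identityʳ (suc i))))) 2i≤m)) ⟩
    (D * D + 0) * n ^ m                  ∎
    where
    open ≤-Reasoning
    rearrange₁ : ∀ a p → (a * a + 0) * p ≡ a * p * a
    rearrange₁ = solve-∀
    rearrange₂ : ∀ d a → d * a * (d * a) ≡ (d * d + 0) * (a * a)
    rearrange₂ = solve-∀
  cost*P≤ (suc j) j≤ = begin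
    (n * size (suc j) + cost j) * P          ≡⟨ rearrange₁ n (size (suc j)) (cost j) P ⟩
    n * (size (suc j) * P) + cost j * P
      ≤⟨ +-mono-≤ (*-monoʳ-≤ n (size*P≤ (suc j))) (cost*P≤ j (≤-trans (n≤1+n _) j≤)) ⟩
    n * (D * n ^ (suc j + suc i)) + (D * D + j * D) * n ^ m
      ≡⟨ cong (_+ (D * D + j * D) * n ^ m) (rearrange₂ n D _) ⟩
    D * n ^ suc (suc j + suc i) + (D * D + j * D) * n ^ m
      ≤⟨ +-monoˡ-≤ _ (*-monoʳ-≤ D (^-monoʳ-≤ n (≤-trans
           (≤-reflexive (sym (+-suc (suc j) (suc i)))) j≤))) ⟩
    D * n ^ m + (D * D + j * D) * n ^ m      ≡⟨ rearrange₃ D j (n ^ m) ⟩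
    (D * D + suc j * D) * n ^ m              ∎
    where
    open ≤-Reasoning
    rearrange₁ : ∀ n s c p → (n * s + c) * p ≡ n * (s * p) + c * p
    rearrange₁ = solve-∀
    rearrange₂ : ∀ n d p → n * (d * p) ≡ d * (n * p)
    rearrange₂ = solve-∀
    rearrange₃ : ∀ d j p → d * p + (d * d + j * d) * p ≡ (d * d + (1 + j) * d) * p
    rearrange₃ = solve-∀

  r̃-bound : r̃ m n * ℓ ^ i ≤ (D * D + (m ∸ (2 + i)) * D) * n ^ m
  r̃-bound = ≤-trans
    (*-monoˡ-≤ P (proj₂ (r̃-correct m n) (cost (m ∸ (2 + i))) (builder-wins (m ∸ (2 + i)) (m∸n+n≡m 3≤))))
    (cost*P≤ (m ∸ (2 + i)) (≤-reflexive (m∸n+n≡m 3≤)))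

-- The logarithm

-- The witness is the floor of (log₂ n) / e. As n grows by one, ℓ changes only when n reaches
-- (2^(ℓ+1))^e, and the next power is then still out of reach.
power-floor : ∀ e n .{{_ : NonZero e}} → 0 < n → ∃[ ℓ ] (2 ^ ℓ) ^ e ≤ n × n < (2 ^ suc ℓ) ^ e
power-floor e (suc zero)    _ = 0 , ≤-reflexive (^-zeroˡ e) ,
  ≤-trans (^-monoʳ-≤ 2 (>-nonZero⁻¹ e)) ≤-refl
power-floor e (suc n@(suc _)) _ with power-floor e n (s≤s z≤n)
... | ℓ , lo , hi with suc n <? (2 ^ suc ℓ) ^ e
...   | yes hi′ = ℓ , ≤-trans lo (n≤1+n n) , hi′
...   | no ¬hi′ = suc ℓ , ≮⇒≥ ¬hi′ ,
  <-≤-trans (s≤s hi) (^-monoˡ-< e (^-monoʳ-< 2 ≤-refl (n<1+n (suc ℓ))))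

^-distribʳ-* : ∀ a b k → (a * b) ^ k ≡ a ^ k * b ^ k
^-distribʳ-* a b zero    = refl
^-distribʳ-* a b (suc k) rewrite ^-distribʳ-* a b k = rearrange a b (a ^ k) (b ^ k)
  where
  rearrange : ∀ a b c d → a * b * (c * d) ≡ a * c * (b * d)
  rearrange = solve-∀

!≤^ : ∀ {K} k → k ≤ K → k ! ≤ K ^ k
!≤^ zero    _   = ≤-refl
!≤^ (suc k) k<K = *-mono-≤ k<K (!≤^ k (<⇒≤ k<K))

-- Rationals are normalised to lowest terms, so the rules for `fromℕ` are derived from plain
-- fractions over 1.
toℚᵘ-fromℕ : ∀ n → ℚ.toℚᵘ (fromℕ n) ℚᵘ.≃ mkℚᵘ (ℤ.+ n) 0
toℚᵘ-fromℕ n = ℚ.toℚᵘ-fromℚᵘ (mkℚᵘ (ℤ.+ n) 0)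

fromℕ-mono : ∀ {a b} → a ≤ b → fromℕ a ℚ.≤ fromℕ b
fromℕ-mono {a} {b} a≤b = ℚ.toℚᵘ-cancel-≤ (begin
  ℚ.toℚᵘ (fromℕ a)  ≃⟨ toℚᵘ-fromℕ a ⟩
  mkℚᵘ (ℤ.+ a) 0    ≤⟨ ℚᵘ.*≤* (ℤ.*-monoʳ-≤-nonNeg (ℤ.+ 1) (ℤ.+≤+ a≤b)) ⟩
  mkℚᵘ (ℤ.+ b) 0    ≃⟨ toℚᵘ-fromℕ b ⟨
  ℚ.toℚᵘ (fromℕ b)  ∎)
  where open ℚᵘ.≤-Reasoning

fromℕ-cancel : ∀ {a b} → fromℕ a ℚ.≤ fromℕ b → a ≤ b
fromℕ-cancel {a} {b} le with begin
  mkℚᵘ (ℤ.+ a) 0    ≃⟨ toℚᵘ-fromℕ a ⟨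
  ℚ.toℚᵘ (fromℕ a)  ≤⟨ ℚ.toℚᵘ-mono-≤ le ⟩
  ℚ.toℚᵘ (fromℕ b)  ≃⟨ toℚᵘ-fromℕ b ⟩
  mkℚᵘ (ℤ.+ b) 0    ∎
  where open ℚᵘ.≤-Reasoning
... | ℚᵘ.*≤* a*1≤b*1 = ℤ.drop‿+≤+ (ℤ.*-cancelʳ-≤-pos (ℤ.+ a) (ℤ.+ b) (ℤ.+ 1) a*1≤b*1)

fromℕ-* : ∀ a b → fromℕ (a * b) ≡ fromℕ a ℚ.* fromℕ b
fromℕ-* a b = ℚ.toℚᵘ-injective (begin
  ℚ.toℚᵘ (fromℕ (a * b))                      ≈⟨ toℚᵘ-fromℕ (a * b) ⟩
  mkℚᵘ (ℤ.+ (a * b)) 0                        ≈⟨ ℚᵘ.*≡* (cong (ℤ._* ℤ.+ 1) (ℤ.pos-* a b)) ⟩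
  mkℚᵘ (ℤ.+ a) 0 ℚᵘ.* mkℚᵘ (ℤ.+ b) 0          ≈⟨ ℚᵘ.*-cong (toℚᵘ-fromℕ a) (toℚᵘ-fromℕ b) ⟨
  ℚ.toℚᵘ (fromℕ a) ℚᵘ.* ℚ.toℚᵘ (fromℕ b)      ≈⟨ ℚ.toℚᵘ-homo-* (fromℕ a) (fromℕ b) ⟨
  ℚ.toℚᵘ (fromℕ a ℚ.* fromℕ b)                ∎)
  where open import Relation.Binary.Reasoning.Setoid ℚᵘ.≃-setoid

fromℕ-^ : ∀ a k → fromℕ (a ^ k) ≡ fromℕ a ^ℚ k
fromℕ-^ a zero    = refl
fromℕ-^ a (suc k) = trans (fromℕ-* a (a ^ k)) (cong (fromℕ a ℚ.*_) (fromℕ-^ a k))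

1/n*n≡1 : ∀ n .{{_ : NonZero n}} → (ℤ.1ℤ ℚ./ n) ℚ.* fromℕ n ≡ 1ℚ
1/n*n≡1 n@(suc n-1) = ℚ.toℚᵘ-injective (begin
  ℚ.toℚᵘ ((ℤ.1ℤ ℚ./ n) ℚ.* fromℕ n)            ≈⟨ ℚ.toℚᵘ-homo-* (ℤ.1ℤ ℚ./ n) (fromℕ n) ⟩
  ℚ.toℚᵘ (ℤ.1ℤ ℚ./ n) ℚᵘ.* ℚ.toℚᵘ (fromℕ n)    ≈⟨ ℚᵘ.*-cong (ℚ.toℚᵘ-fromℚᵘ (mkℚᵘ ℤ.1ℤ n-1)) (toℚᵘ-fromℕ n) ⟩
  mkℚᵘ ℤ.1ℤ n-1 ℚᵘ.* mkℚᵘ (ℤ.+ n) 0            ≈⟨ ℚᵘ.*≡* (cong ℤ.+_ (rearrange n-1)) ⟩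
  ℚ.toℚᵘ 1ℚ                                    ∎)
  where
  open import Relation.Binary.Reasoning.Setoid ℚᵘ.≃-setoid
  rearrange : ∀ k → (suc k + 0) * 1 ≡ suc k * 1 + 0
  rearrange = solve-∀

fromℕ≥0 : ∀ n → 0ℚ ℚ.≤ fromℕ n
fromℕ≥0 n = fromℕ-mono {0} {n} z≤n

*-mono-≤-ℚ : ∀ {p q r s} → 0ℚ ℚ.≤ p → 0ℚ ℚ.≤ s → p ℚ.≤ q → r ℚ.≤ s → p ℚ.* r ℚ.≤ q ℚ.* s
*-mono-≤-ℚ {p} {q} {r} {s} 0≤p 0≤s p≤q r≤s =
  ℚ.≤-trans (ℚ.*-monoˡ-≤-nonNeg p {{ℚ.nonNegative 0≤p}} r≤s)
            (ℚ.*-monoʳ-≤-nonNeg s {{ℚ.nonNegative 0≤s}} p≤q)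

*-≥0 : ∀ {p q} → 0ℚ ℚ.≤ p → 0ℚ ℚ.≤ q → 0ℚ ℚ.≤ p ℚ.* q
*-≥0 {p} {q} 0≤p 0≤q = ℚ.nonNegative⁻¹ (p ℚ.* q)
  {{ℚ.nonNeg*nonNeg⇒nonNeg p {{ℚ.nonNegative 0≤p}} q {{ℚ.nonNegative 0≤q}}}}

^-≥0 : ∀ {q} k → 0ℚ ℚ.≤ q → 0ℚ ℚ.≤ q ^ℚ k
^-≥0 zero    0≤q = fromℕ≥0 1
^-≥0 (suc k) 0≤q = *-≥0 0≤q (^-≥0 k 0≤q)

^-mono-ℚ : ∀ {p q} k → 0ℚ ℚ.≤ p → p ℚ.≤ q → p ^ℚ k ℚ.≤ q ^ℚ k
^-mono-ℚ zero    0≤p p≤q = ℚ.≤-refl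
^-mono-ℚ (suc k) 0≤p p≤q =
  *-mono-≤-ℚ 0≤p (^-≥0 k (ℚ.≤-trans 0≤p p≤q)) p≤q (^-mono-ℚ k 0≤p p≤q)

1/n≥0 : ∀ n .{{_ : NonZero n}} → 0ℚ ℚ.≤ ℤ.1ℤ ℚ./ n
1/n≥0 n = ℚ.nonNegative⁻¹ (ℤ.1ℤ ℚ./ n) {{ℚ.normalize-nonNeg 1 n}}

expSum≥0 : ∀ {q} k → 0ℚ ℚ.≤ q → 0ℚ ℚ.≤ expSum q k
expSum≥0 zero    0≤q = ℚ.≤-refl
expSum≥0 {q} (suc k) 0≤q =
  ℚ.+-mono-≤ (expSum≥0 k 0≤q) (*-≥0 (^-≥0 k 0≤q) (1/n≥0 (k !) {{k !≢0}}))

-- Otherwise the K-th term of the series for exp q is at least (2K)^K / K! ≥ 2^K > n.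
log-upper : ∀ {q n} K → n < 2 ^ K → q ∈[0,log n ] → q ℚ.≤ fromℕ (2 * K)
log-upper {q} {n} K n<2^K (0≤q , sums≤n) with q ℚ.≤? fromℕ (2 * K)
... | yes q≤ = q≤
... | no q≰  = contradiction n<2^K (≤⇒≯ (*-cancelʳ-≤ (2 ^ K) n (K ^ K) {{K^K≢0 K}} (begin
  2 ^ K * K ^ K   ≡⟨ ^-distribʳ-* 2 K K ⟨
  (2 * K) ^ K     ≤⟨ fromℕ-cancel in-ℚ ⟩
  n * K !         ≤⟨ *-monoʳ-≤ n (!≤^ K ≤-refl) ⟩
  n * K ^ K       ∎)))
  where
  open ≤-Reasoning
  K^K≢0 : ∀ K → NonZero (K ^ K)
  K^K≢0 zero    = _
  K^K≢0 (suc K) = m^n≢0 (suc K) (suc K)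
  instance
    K!≢0 : NonZero (K !)
    K!≢0 = K !≢0
  -- This term is the last summand of `expSum q (suc K)`, and the preceding ones have nonnegative
  -- sum.
  term≤n : q ^ℚ K ℚ.* (ℤ.1ℤ ℚ./ (K !)) ℚ.≤ fromℕ n
  term≤n = ℚ.≤-trans (ℚ.≤-trans (ℚ.≤-reflexive (sym (ℚ.+-identityˡ _)))
    (ℚ.+-monoˡ-≤ _ (expSum≥0 K 0≤q))) (sums≤n (suc K))
  in-ℚ : fromℕ ((2 * K) ^ K) ℚ.≤ fromℕ (n * K !)
  in-ℚ = ℚR.begin
    fromℕ ((2 * K) ^ K)  ℚR.≡⟨ fromℕ-^ (2 * K) K ⟩
    fromℕ (2 * K) ^ℚ K   ℚR.≤⟨ ^-mono-ℚ K (fromℕ≥0 (2 * K)) (ℚ.<⇒≤ (ℚ.≰⇒> q≰)) ⟩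
    q ^ℚ K               ℚR.≡⟨ ℚ.*-identityʳ (q ^ℚ K) ⟨
    q ^ℚ K ℚ.* 1ℚ        ℚR.≡⟨ cong (q ^ℚ K ℚ.*_) (1/n*n≡1 (K !)) ⟨
    q ^ℚ K ℚ.* ((ℤ.1ℤ ℚ./ (K !)) ℚ.* fromℕ (K !))
                         ℚR.≡⟨ ℚ.*-assoc (q ^ℚ K) _ _ ⟨
    q ^ℚ K ℚ.* (ℤ.1ℤ ℚ./ (K !)) ℚ.* fromℕ (K !)
                         ℚR.≤⟨ ℚ.*-monoʳ-≤-nonNeg (fromℕ (K !)) {{ℚ.nonNegative (fromℕ≥0 (K !))}} term≤n ⟩
    fromℕ n ℚ.* fromℕ (K !) ℚR.≡⟨ fromℕ-* n (K !) ⟨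
    fromℕ (n * K !)      ℚR.∎
    where module ℚR = ℚ.≤-Reasoning

theorem5 : ∀ (m : ℕ) → 3 ≤ m →
    Σ[ C ∈ ℕ ] Σ[ N ∈ ℕ ] (∀ (n : ℕ) → N ≤ n →
    r̃ m n ·[log n ]^ (m / 2 ∸ 1) ≤ C * n ^ m)
theorem5 m 3≤m = (4 * e) ^ i * C , 2 ^ e , bound
  where
  i e D C : ℕ
  i = m / 2 ∸ 1
  -- The exponent in the Ramsey bound, so that ℓ is about log₂ n / e.
  e = i + 4
  D = 6 * 2 ^ i
  C = D * D + (m ∸ (2 + i)) * D
  1≤m/2 : 1 ≤ m / 2
  1≤m/2 = *≤⇒≤/ {1} {2} (≤-trans (n≤1+n 2) 3≤m)
  suc-i : suc i ≡ m / 2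
  suc-i = trans (+-comm 1 i) (m∸n+n≡m 1≤m/2)
  2*suc-i≤m : 2 * suc i ≤ m
  2*suc-i≤m = begin
    2 * suc i     ≡⟨ *-comm 2 (suc i) ⟩
    suc i * 2     ≡⟨ cong (_* 2) suc-i ⟩
    m / 2 * 2     ≤⟨ m/n*n≤m m 2 ⟩
    m             ∎
    where open ≤-Reasoning
  2+i≤m : 2 + i ≤ m
  2+i≤m = ≤-trans (≤-trans (≤-reflexive (+-comm 1 (suc i)))
                          (+-monoʳ-≤ (suc i) (s≤s z≤n))) 2*suc-i≤m
  instance
    e≢0 : NonZero e
    e≢0 = >-nonZero (≤-trans (s≤s z≤n) (m≤n+m 4 i))
  bound : ∀ n → 2 ^ e ≤ n → r̃ m n ·[log n ]^ i ≤ ((4 * e) ^ i * C * n ^ m)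
  bound n n-large q q∈ with power-floor e n (≤-trans (m^n>0 2 e) n-large)
  -- ℓ = 0 would mean n < 2^e; the threshold for n is chosen to exclude this.
  ... | zero , _ , n< = contradiction n< (≤⇒≯ n-large)
  ... | ℓ@(suc _) , lo , hi = ℚR.begin
    fromℕ (r̃ m n) ℚ.* q ^ℚ i
      ℚR.≤⟨ ℚ.*-monoˡ-≤-nonNeg (fromℕ (r̃ m n)) {{ℚ.nonNegative (fromℕ≥0 (r̃ m n))}}
           (^-mono-ℚ i (proj₁ q∈) (log-upper K n<2^K q∈)) ⟩
    fromℕ (r̃ m n) ℚ.* fromℕ (2 * K) ^ℚ i
      ℚR.≡⟨ cong (fromℕ (r̃ m n) ℚ.*_) (fromℕ-^ (2 * K) i) ⟨
    fromℕ (r̃ m n) ℚ.* fromℕ ((2 * K) ^ i)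
      ℚR.≡⟨ fromℕ-* (r̃ m n) ((2 * K) ^ i) ⟨
    fromℕ (r̃ m n * (2 * K) ^ i)
      ℚR.≤⟨ fromℕ-mono in-ℕ ⟩
    fromℕ ((4 * e) ^ i * C * n ^ m) ℚR.∎
    where
    module ℚR = ℚ.≤-Reasoning
    -- As ℓ ≥ 1, (ℓ+1)e ≤ 2ℓe = K. Thus `log-upper` gives q ≤ 2K = 4eℓ, the source of the factor
    -- (4e)^i.
    K : ℕ
    K = 2 * ℓ * e
    n<2^K : n < 2 ^ K
    n<2^K = <-≤-trans hi (≤-trans (≤-reflexive (^-*-assoc 2 (suc ℓ) e))
      (^-monoʳ-≤ 2 (*-monoˡ-≤ e (≤-trans (≤-reflexive (+-comm 1 ℓ))
                                           (+-monoʳ-≤ ℓ (s≤s z≤n))))))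
    in-ℕ : r̃ m n * (2 * K) ^ i ≤ (4 * e) ^ i * C * n ^ m
    in-ℕ = begin
      r̃ m n * (2 * K) ^ i               ≡⟨ cong (λ x → r̃ m n * x ^ i) (rearrange₁ ℓ e) ⟩
      r̃ m n * (4 * e * ℓ) ^ i           ≡⟨ cong (r̃ m n *_) (^-distribʳ-* (4 * e) ℓ i) ⟩
      r̃ m n * ((4 * e) ^ i * ℓ ^ i)     ≡⟨ rearrange₂ (r̃ m n) ((4 * e) ^ i) (ℓ ^ i) ⟩
      (4 * e) ^ i * (r̃ m n * ℓ ^ i)     ≤⟨ *-monoʳ-≤ ((4 * e) ^ i)
                                             (Bound.r̃-bound i m n ℓ 2+i≤m 2*suc-i≤m (s≤s z≤n) lo) ⟩
      (4 * e) ^ i * (C * n ^ m)         ≡⟨ *-assoc ((4 * e) ^ i) C (n ^ m) ⟨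
      (4 * e) ^ i * C * n ^ m           ∎
      where
      open ≤-Reasoning
      rearrange₁ : ∀ l e → 2 * (2 * l * e) ≡ 4 * e * l
      rearrange₁ = solve-∀
      rearrange₂ : ∀ r a b → r * (a * b) ≡ a * (r * b)
      rearrange₂ = solve-∀
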